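{- There is an absolute constant $C>0$ such that for every (sufficiently large) prime $p$ and every integer $\lambda$ there exist positive integers $m,n,n_1,\ldots,n_{47}$ with $$\max\{m,n,n_1,\ldots,n_{47}\}\leqslant C\,p^{1300/1301}$$ such that $$m!\,n!+\sum_{i=1}^{47} n_i!\equiv \lambda \pmod p.$$
   Context: $p$ denotes a large prime. -}

module Defs where

open import Data.Nat using (ℕ; zero; suc; _+_)
open import Data.Fin using (Fin)
import Data.Fin as F

finSum : (n : ℕ) → (Fin n → ℕ) → ℕ
finSum zero    f = 0
finSum (suc n) f = f F.zero + finSum n (λ i → f (F.suc i))

{-# OPTIONS --safe #-}
-- Let X be the multiset of sums of 23 factorials (n + 1 + k)!, one from each of 23 consecutive intervals of
-- length K. For a typical n almost all of these sums are distinct modulo p, since a coincidence makes n a root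
-- of a nonzero polynomial of degree less than 23 K. Put h = p 1_X - |X|, c(t) = Σ_z h(z) h(z + t) and
-- D(ρ) = Σ_w c(w) c(ρ w). If u v + x + y avoids a residue for u ∈ U, v ∈ V, x, y ∈ X, then Cauchy-Schwarz,
-- applied over y and then over the differences v - v', bounds |U| |V| |X|² in terms of the additive energies of
-- X and V and of Σ D(u'/u) over u, u' ∈ U. Now D ≥ 0 and Σ_ρ D(ρ) = p c(0)². When U consists of consecutive
-- factorials, u'/u is a value of some (n + 1)...(n + d), and this polynomial takes each value at most d times;
-- so for a suitable block U the terms with u ≠ u' contribute little. Taking V to be a block of about N^(1/3)
-- consecutive factorials with few coincidences v₁ - v₂ = v₃ - v₄, where all arguments are at most 2N, the
-- resulting inequality fails for N = p^(264/265). One summand of the 47 is spent on 1!.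
module Submission where

open import Data.Product using (Σ; _×_; _,_; ∃-syntax; proj₁; proj₂)
open import Data.Sum as Sum using (_⊎_; inj₁; inj₂; [_,_]′)
open import Data.Unit using (tt)
open import Function.Base using (id; _∘_)
open import Relation.Binary.Definitions using (tri<; tri≈; tri>)
open import Relation.Binary.PropositionalEquality
open import Relation.Nullary using (¬_; Dec; yes; no; contradiction)
open import Relation.Nullary.Decidable using (map′)
import Data.Fin.Properties as Fin
import Data.Integer.Base as ℤ
import Data.Integer.Properties as ℤ
import Data.Integer.Divisibility.Signed as Signed
import Data.Integer.Tactic.RingSolver as ℤ
import Data.Nat.Base as ℕ
import Data.Nat.Properties as ℕ
import Data.Nat.Divisibility as ℕ
import Data.Nat.Tactic.RingSolver as ℕ

-- Subtracting the mean from 1_X removes the main term: c then sums to zero, so Σ_ρ D(ρ) reduces to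
-- the contribution of w = 0. Positivity of D lets a sum over the few ratios u'/u be bounded by the
-- sum over all ρ. These two facts stand in for Fourier analysis, and the factor p in h keeps
-- everything integral. No individual block of factorials is known to behave well, so the starting
-- points for X, V and U are each chosen by averaging over n < N; U comes after X, because D depends
-- on X. Relative to |U|², the diagonal terms u = u' shrink like 1/|U| while the bound for the other
-- terms grows like |U|; balancing the two fixes the length of U. The surviving gain is only
-- N^(1/48), to be set against the powers of p/N that are lost, and this is why N has to lie so
-- close to p.

module Counting where

  open import Data.Fin.Base using (Fin; zero; suc; toℕ)
  open import Data.Integer.Base using (ℤ; +_; _+_; _-_; _*_; -_; _≤_; +≤+; 0ℤ; 1ℤ; nonNegative; Positive)
  open import Data.Integer.DivMod using (_%ℕ_; _/ℕ_; n%ℕd<d; a≡a%ℕn+[a/ℕn]*n)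
  open import Data.Integer.Divisibility.Signed
  open import Data.Integer.Properties
  open import Data.Integer.Tactic.RingSolver using (solve-∀)
  open import Data.List.Base using (List; []; _∷_; _++_; map; length; downFrom; allFin; cartesianProduct; cartesianProductWith)
  open import Data.List.Properties using (map-tabulate; length-tabulate; length-downFrom; length-++; length-map)
  open import Data.Nat.Base using (ℕ; zero; suc; _!)
  open import Data.Nat.Coprimality using (Coprime; coprime-Bézout)
  open import Data.Nat.GCD using (module Bézout)
  open import Data.Nat.Primality using (Prime; prime⇒nonZero; prime⇒nonTrivial; prime⇒irreducible; euclidsLemma)
  open import Data.Vec.Base using (Vec; []; _∷_)

  private variable
    A B C E : Set

  -- Order and multiplication in the integers

  *-monoˡ : ∀ c {x y} → 0ℤ ≤ c → x ≤ y → c * x ≤ c * y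
  *-monoˡ c 0≤c x≤y = *-monoˡ-≤-nonNeg c {{nonNegative 0≤c}} x≤y

  *-monoʳ : ∀ c {x y} → 0ℤ ≤ c → x ≤ y → x * c ≤ y * c
  *-monoʳ c 0≤c x≤y = *-monoʳ-≤-nonNeg c {{nonNegative 0≤c}} x≤y

  *-mono : ∀ {a b c d} → 0ℤ ≤ a → 0ℤ ≤ d → a ≤ b → c ≤ d → a * c ≤ b * d
  *-mono {a} {d = d} 0≤a 0≤d a≤b c≤d = ≤-trans (*-monoˡ a 0≤a c≤d) (*-monoʳ d 0≤d a≤b)

  0≤+ : ∀ {a b} → 0ℤ ≤ a → 0ℤ ≤ b → 0ℤ ≤ a + b
  0≤+ = +-mono-≤

  0≤* : ∀ {a b} → 0ℤ ≤ a → 0ℤ ≤ b → 0ℤ ≤ a * b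
  0≤* {a} {b} 0≤a 0≤b = subst (_≤ a * b) (*-zeroʳ a) (*-monoˡ a 0≤a 0≤b)

  0≤-square : ∀ a → 0ℤ ≤ a * a
  0≤-square (+ n)          = 0≤* {+ n} {+ n} (+≤+ ℕ.z≤n) (+≤+ ℕ.z≤n)
  0≤-square (ℤ.negsuc n) = +≤+ ℕ.z≤n

  0≤-pos : ∀ {n} → 0ℤ ≤ + n
  0≤-pos = +≤+ ℕ.z≤n

  +-congʳ : ∀ a {b c} → b ≡ c → a + b ≡ a + c
  +-congʳ a = cong (λ s → a + s)

  -- Finite sums

  ∑ : List A → (A → ℤ) → ℤ
  ∑ []       f = 0ℤ
  ∑ (x ∷ xs) f = f x + ∑ xs f

  infix 5 ∑
  syntax ∑ xs (λ x → e) = ∑[ x ∈ xs ] e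

  module _ {f g : A → ℤ} where

    ∑-cong : (∀ x → f x ≡ g x) → ∀ xs → ∑ xs f ≡ ∑ xs g
    ∑-cong f≡g []       = refl
    ∑-cong f≡g (x ∷ xs) = cong₂ _+_ (f≡g x) (∑-cong f≡g xs)

    ∑-mono : (∀ x → f x ≤ g x) → ∀ xs → ∑ xs f ≤ ∑ xs g
    ∑-mono f≤g []       = ≤-refl
    ∑-mono f≤g (x ∷ xs) = +-mono-≤ (f≤g x) (∑-mono f≤g xs)

  ∑-+ : ∀ (f g : A → ℤ) xs → ∑[ x ∈ xs ] (f x + g x) ≡ ∑ xs f + ∑ xs g
  ∑-+ f g []       = refl
  ∑-+ f g (x ∷ xs) = trans (+-congʳ (f x + g x) (∑-+ f g xs)) (lem (f x) (g x) (∑ xs f) (∑ xs g))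
    where
    lem : ∀ a b c d → a + b + (c + d) ≡ a + c + (b + d)
    lem = solve-∀

  ∑-*ˡ : ∀ c (f : A → ℤ) xs → ∑[ x ∈ xs ] (c * f x) ≡ c * ∑ xs f
  ∑-*ˡ c f []       = sym (*-zeroʳ c)
  ∑-*ˡ c f (x ∷ xs) = trans (+-congʳ (c * f x) (∑-*ˡ c f xs)) (sym (*-distribˡ-+ c (f x) (∑ xs f)))

  ∑-*ʳ : ∀ c (f : A → ℤ) xs → ∑[ x ∈ xs ] (f x * c) ≡ ∑ xs f * c
  ∑-*ʳ c f xs = trans (∑-cong (λ x → *-comm (f x) c) xs) (trans (∑-*ˡ c f xs) (*-comm c (∑ xs f)))

  ∑-const : ∀ c (xs : List A) → ∑[ x ∈ xs ] c ≡ + length xs * c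
  ∑-const c []       = sym (*-zeroˡ c)
  ∑-const c (x ∷ xs) = trans (+-congʳ c (∑-const c xs)) (sym (suc-* (+ length xs) c))

  ∑-zero : ∀ (xs : List A) → ∑[ x ∈ xs ] 0ℤ ≡ 0ℤ
  ∑-zero []       = refl
  ∑-zero (x ∷ xs) = trans (+-identityˡ _) (∑-zero xs)

  ∑-nonNeg : {f : A → ℤ} → (∀ x → 0ℤ ≤ f x) → ∀ xs → 0ℤ ≤ ∑ xs f
  ∑-nonNeg 0≤f []       = ≤-refl
  ∑-nonNeg 0≤f (x ∷ xs) = 0≤+ (0≤f x) (∑-nonNeg 0≤f xs)

  ∑-swap : ∀ (f : A → B → ℤ) xs ys → ∑[ x ∈ xs ] ∑[ y ∈ ys ] f x y ≡ ∑[ y ∈ ys ] ∑[ x ∈ xs ] f x y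
  ∑-swap f []       ys = sym (∑-zero ys)
  ∑-swap f (x ∷ xs) ys = trans (+-congʳ (∑ ys (f x)) (∑-swap f xs ys))
                               (sym (∑-+ (f x) (λ y → ∑[ x ∈ xs ] f x y) ys))

  ∑-++ : ∀ (f : A → ℤ) xs ys → ∑ (xs ++ ys) f ≡ ∑ xs f + ∑ ys f
  ∑-++ f []       ys = sym (+-identityˡ _)
  ∑-++ f (x ∷ xs) ys = trans (+-congʳ (f x) (∑-++ f xs ys)) (sym (+-assoc (f x) _ _))

  ∑-map : ∀ (f : B → ℤ) (g : A → B) xs → ∑ (map g xs) f ≡ ∑ xs (f ∘ g)
  ∑-map f g []       = refl
  ∑-map f g (x ∷ xs) = +-congʳ (f (g x)) (∑-map f g xs)

  ∑-product : ∀ (f : C → ℤ) (g : A → B → C) xs ys →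
              ∑ (cartesianProductWith g xs ys) f ≡ ∑[ x ∈ xs ] ∑[ y ∈ ys ] f (g x y)
  ∑-product f g []       ys = refl
  ∑-product f g (x ∷ xs) ys = trans (∑-++ f (map (g x) ys) _) (cong₂ _+_ (∑-map f (g x) ys) (∑-product f g xs ys))

  ∑-*-∑ : ∀ (f : A → ℤ) (g : B → ℤ) xs ys → ∑[ x ∈ xs ] ∑[ y ∈ ys ] f x * g y ≡ ∑ xs f * ∑ ys g
  ∑-*-∑ f g xs ys = trans (∑-cong (λ x → ∑-*ˡ (f x) g ys) xs) (∑-*ʳ (∑ ys g) f xs)

  -- Lagrange's identity: the double sum of the squares of `f x * g y - f y * g x` is twice the
  -- difference of the two sides.
  cauchy-schwarz : ∀ {A : Set} (f g : A → ℤ) xs →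
    (∑[ x ∈ xs ] f x * g x) * (∑[ x ∈ xs ] f x * g x) ≤ (∑[ x ∈ xs ] f x * f x) * (∑[ x ∈ xs ] g x * g x)
  cauchy-schwarz {A} f g xs = half (subst (0ℤ ≤_) expand (∑-nonNeg (λ x → ∑-nonNeg (λ y → 0≤-square (f x * g y - f y * g x)) xs) xs))
    where
    ff fg gg : ℤ
    ff = ∑[ x ∈ xs ] f x * f x
    fg = ∑[ x ∈ xs ] f x * g x
    gg = ∑[ x ∈ xs ] g x * g x
    term : ∀ a b c d → (a * d - c * b) * (a * d - c * b) ≡ (a * a) * (d * d) + ((b * b) * (c * c) + (- + 2) * ((a * b) * (c * d)))
    term = solve-∀
    expand : ∑[ x ∈ xs ] ∑[ y ∈ xs ] (f x * g y - f y * g x) * (f x * g y - f y * g x) ≡ ff * gg + (gg * ff + (- + 2) * (fg * fg))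
    expand = begin
      ∑[ x ∈ xs ] ∑[ y ∈ xs ] (f x * g y - f y * g x) * (f x * g y - f y * g x)
        ≡⟨ ∑-cong (λ x → ∑-cong (λ y → term (f x) (g x) (f y) (g y)) xs) xs ⟩
      ∑[ x ∈ xs ] ∑[ y ∈ xs ] (t₁ x y + (t₂ x y + (- + 2) * t₃ x y))
        ≡⟨ ∑-cong (λ x → split (t₁ x) (t₂ x) (t₃ x)) xs ⟩
      ∑[ x ∈ xs ] (∑ xs (t₁ x) + (∑ xs (t₂ x) + (- + 2) * ∑ xs (t₃ x)))
        ≡⟨ split (λ x → ∑ xs (t₁ x)) (λ x → ∑ xs (t₂ x)) (λ x → ∑ xs (t₃ x)) ⟩
      (∑[ x ∈ xs ] ∑ xs (t₁ x)) + ((∑[ x ∈ xs ] ∑ xs (t₂ x)) + (- + 2) * (∑[ x ∈ xs ] ∑ xs (t₃ x)))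
        ≡⟨ cong₂ _+_ (∑-*-∑ _ _ xs xs) (cong₂ (λ a b → a + (- + 2) * b) (∑-*-∑ _ _ xs xs) (∑-*-∑ _ _ xs xs)) ⟩
      ff * gg + (gg * ff + (- + 2) * (fg * fg)) ∎
      where
      open ≡-Reasoning
      t₁ t₂ t₃ : A → A → ℤ
      t₁ x y = (f x * f x) * (g y * g y)
      t₂ x y = (g x * g x) * (f y * f y)
      t₃ x y = (f x * g x) * (f y * g y)
      split : ∀ s t r → ∑[ x ∈ xs ] (s x + (t x + (- + 2) * r x)) ≡ ∑ xs s + (∑ xs t + (- + 2) * ∑ xs r)
      split s t r = trans (∑-+ s (λ x → t x + (- + 2) * r x) xs) (+-congʳ (∑ xs s) (trans (∑-+ t (λ x → (- + 2) * r x) xs) (+-congʳ (∑ xs t) (∑-*ˡ (- + 2) r xs))))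
    half : 0ℤ ≤ ff * gg + (gg * ff + (- + 2) * (fg * fg)) → fg * fg ≤ ff * gg
    half h = *-cancelˡ-≤-pos (fg * fg) (ff * gg) (+ 2) (0≤i-j⇒j≤i (subst (0ℤ ≤_) (eq (ff) gg fg) h))
      where
      eq : ∀ a b c → a * b + (b * a + (- + 2) * (c * c)) ≡ + 2 * (a * b) - + 2 * (c * c)
      eq = solve-∀

  square-∑ : ∀ (f : A → ℤ) xs → ∑ xs f * ∑ xs f ≤ + length xs * (∑[ x ∈ xs ] f x * f x)
  square-∑ f xs = subst₂ _≤_ (cong (λ s → s * s) (∑-cong {f = λ x → 1ℤ * f x} (λ x → *-identityˡ (f x)) xs))
                             (cong (_* (∑[ x ∈ xs ] f x * f x)) (trans (∑-const 1ℤ xs) (*-identityʳ (+ length xs))))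
                             (cauchy-schwarz (λ _ → 1ℤ) f xs)

  ∑<-cong : ∀ {f g : ℕ → ℤ} n → (∀ i → i ℕ.< n → f i ≡ g i) → ∑ (downFrom n) f ≡ ∑ (downFrom n) g
  ∑<-cong zero    f≡g = refl
  ∑<-cong (suc n) f≡g = cong₂ _+_ (f≡g n ℕ.≤-refl) (∑<-cong n λ i i<n → f≡g i (ℕ.m<n⇒m<1+n i<n))

  ∑<-mono : ∀ {f g : ℕ → ℤ} n → (∀ i → i ℕ.< n → f i ≤ g i) → ∑ (downFrom n) f ≤ ∑ (downFrom n) g
  ∑<-mono zero    f≤g = ≤-refl
  ∑<-mono (suc n) f≤g = +-mono-≤ (f≤g n ℕ.≤-refl) (∑<-mono n λ i i<n → f≤g i (ℕ.m<n⇒m<1+n i<n))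

  ∑<-single : ∀ {f : ℕ → ℤ} n k → k ℕ.< n → (∀ i → i ℕ.< n → i ≢ k → f i ≡ 0ℤ) → ∑ (downFrom n) f ≡ f k
  ∑<-single {f} (suc n) k k<1+n f≡0 with k ℕ.≟ n
  ... | yes refl = trans (+-congʳ (f n) (trans (∑<-cong n (λ i i<n → f≡0 i (ℕ.m<n⇒m<1+n i<n) (ℕ.<⇒≢ i<n))) (∑-zero (downFrom n)))) (+-identityʳ (f n))

  ... | no k≢n = trans (cong₂ _+_ (f≡0 n ℕ.≤-refl (k≢n ∘ sym)) (∑<-single n k (ℕ.≤∧≢⇒< (ℕ.s≤s⁻¹ k<1+n) k≢n) (λ i i<n → f≡0 i (ℕ.m<n⇒m<1+n i<n)))) (+-identityˡ (f k))

  below-average : ∀ (f : ℕ → ℤ) n .{{_ : ℕ.NonZero n}} → ∃[ k ] (k ℕ.< n × + n * f k ≤ ∑ (downFrom n) f)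
  below-average f (suc zero) = zero , ℕ.≤-refl , ≤-reflexive (trans (*-identityˡ (f 0)) (sym (+-identityʳ (f 0))))
  below-average f (suc n@(suc _)) with below-average f n
  ... | k , k<n , avg with ≤-total (f k) (f n)
  ...   | inj₁ fk≤ = k , ℕ.m<n⇒m<1+n k<n , ≤-trans (≤-reflexive (suc-* (+ n) (f k))) (+-mono-≤ fk≤ avg)
  ...   | inj₂ ≤fk = n , ℕ.≤-refl , ≤-trans (≤-reflexive (suc-* (+ n) (f n))) (+-monoʳ-≤ (f n) (≤-trans (*-monoˡ (+ n) 0≤-pos ≤fk) avg))

  -- Indicators of decidable propositions

  ind : Dec A → ℤ
  ind (yes _) = 1ℤ
  ind (no  _) = 0ℤ

  ind-yes : ∀ (d : Dec A) → A → ind d ≡ 1ℤ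
  ind-yes (yes _) a = refl
  ind-yes (no ¬a) a = contradiction a ¬a

  ind-no : ∀ (d : Dec A) → ¬ A → ind d ≡ 0ℤ
  ind-no (yes a) ¬a = contradiction a ¬a
  ind-no (no _)  ¬a = refl

  ind-nonNeg : ∀ (d : Dec A) → 0ℤ ≤ ind d
  ind-nonNeg (yes _) = +≤+ ℕ.z≤n
  ind-nonNeg (no  _) = ≤-refl

  ind-≤1 : ∀ (d : Dec A) → ind d ≤ 1ℤ
  ind-≤1 (yes _) = ≤-refl
  ind-≤1 (no  _) = +≤+ ℕ.z≤n

  ind-mono : ∀ (d : Dec A) (e : Dec B) → (A → B) → ind d ≤ ind e
  ind-mono (yes a) e f = ≤-reflexive (sym (ind-yes e (f a)))
  ind-mono (no _)  e f = ind-nonNeg e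

  ind-cong : ∀ (d : Dec A) (e : Dec B) → (A → B) → (B → A) → ind d ≡ ind e
  ind-cong d e f g = ≤-antisym (ind-mono d e f) (ind-mono e d g)

  ∣-multiple : ∀ {d a b} k → b ≡ k * a → d ∣ a → d ∣ b
  ∣-multiple {d} k eq d∣a = subst (d ∣_) (sym eq) (∣n⇒∣m*n k d∣a)

  -- Sums of functions on the residues modulo p

  module Residues (p : ℕ) (p-prime : Prime p) where

    private instance
      _ = prime⇒nonZero p-prime

    P : ℤ
    P = + p

    ∣-small : ∀ {i j} → i ℕ.< p → j ℕ.< p → P ∣ + i - + j → i ≡ j
    ∣-small {i} {j} i<p j<p d with ℕ.<-cmp i j
    ... | tri≈ _ i≡j _ = i≡j
    ... | tri< i<j _ _ = contradiction (ℕ.∣⇒≤ {{ℕ.>-nonZero (ℕ.m<n⇒0<n∸m i<j)}} p∣) (ℕ.<⇒≱ (ℕ.≤-<-trans (ℕ.m∸n≤m j i) j<p))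
      where
      p∣ : p ℕ.∣ j ℕ.∸ i
      p∣ = subst (p ℕ.∣_) (trans (cong ℤ.∣_∣ (m-n≡m⊖n i j)) (∣⊖∣-≤ (ℕ.<⇒≤ i<j))) (∣⇒∣ᵤ d)
    ... | tri> _ _ j<i = contradiction (ℕ.∣⇒≤ {{ℕ.>-nonZero (ℕ.m<n⇒0<n∸m j<i)}} p∣) (ℕ.<⇒≱ (ℕ.≤-<-trans (ℕ.m∸n≤m i j) i<p))
      where
      p∣ : p ℕ.∣ i ℕ.∸ j
      p∣ = subst (p ℕ.∣_) (trans (cong ℤ.∣_∣ (m-n≡m⊖n i j)) (trans (∣m⊖n∣≡∣n⊖m∣ i j) (∣⊖∣-≤ (ℕ.<⇒≤ j<i)))) (∣⇒∣ᵤ d)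

    euclid : ∀ a b → P ∣ a * b → P ∣ a ⊎ P ∣ b
    euclid a b d = Sum.map ∣ᵤ⇒∣ ∣ᵤ⇒∣ (euclidsLemma ℤ.∣ a ∣ ℤ.∣ b ∣ p-prime (subst (p ℕ.∣_) (abs-* a b) (∣⇒∣ᵤ d)))

    inverse : ∀ u → ¬ P ∣ + u → ∃[ v ] P ∣ v * + u - 1ℤ
    inverse u p∤u with coprime-Bézout coprime
      where
      coprime : Coprime u p
      coprime {i} (i∣u , i∣p) with prime⇒irreducible p-prime i∣p
      ... | inj₁ i≡1  = i≡1
      ... | inj₂ refl = contradiction (∣ᵤ⇒∣ i∣u) p∤u
    ... | Bézout.+- x y eq = + x , divides (+ y) (trans (cong (_- 1ℤ) xu) (lem (+ y * P)))
      where
      xu : + x * + u ≡ 1ℤ + + y * P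
      xu = trans (sym (pos-* x u)) (trans (cong +_ (sym eq)) (+-congʳ 1ℤ (pos-* y p)))
      lem : ∀ a → 1ℤ + a - 1ℤ ≡ a
      lem = solve-∀
    ... | Bézout.-+ x y eq = - + x , divides (- + y) (trans (lem (+ x) (+ u)) (trans (cong -_ xu) (neg-distribˡ-* (+ y) P)))
      where
      xu : 1ℤ + + x * + u ≡ + y * P
      xu = trans (+-congʳ 1ℤ (sym (pos-* x u))) (trans (cong +_ eq) (pos-* y p))
      lem : ∀ a b → - a * b - 1ℤ ≡ - (1ℤ + a * b)
      lem = solve-∀

    δ : ℤ → ℤ
    δ z = ind (P ∣? z)

    δ-nonNeg : ∀ z → 0ℤ ≤ δ z
    δ-nonNeg z = ind-nonNeg (P ∣? z)

    δ-mono : ∀ {a b} → (P ∣ a → P ∣ b) → δ a ≤ δ b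
    δ-mono {a} {b} = ind-mono (P ∣? a) (P ∣? b)

    δ-cong : ∀ {a b} → (P ∣ a → P ∣ b) → (P ∣ b → P ∣ a) → δ a ≡ δ b
    δ-cong {a} {b} = ind-cong (P ∣? a) (P ∣? b)

    δ-neg : ∀ {a b} → b ≡ - a → δ a ≡ δ b
    δ-neg {a} refl = δ-cong ∣m⇒∣-m (λ d → subst (P ∣_) (neg-involutive a) (∣m⇒∣-m d))

    -- Functions on ℤ/p are represented by functions on ℤ that are constant on residue classes,
    -- which spares a quotient type; `∮` then sums over the representatives below p.
    Periodic : (ℤ → ℤ) → Set
    Periodic f = ∀ a b → P ∣ a - b → f a ≡ f b

    δ-periodic : ∀ x → Periodic (λ z → δ (z - x))
    δ-periodic x a b d = δ-cong
      (λ e → subst (P ∣_) (lem₁ a b x) (∣m∣n⇒∣m-n e d))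
      (λ e → subst (P ∣_) (lem₂ a b x) (∣m∣n⇒∣m+n e d))
      where
      lem₁ : ∀ a b x → (a - x) - (a - b) ≡ b - x
      lem₁ = solve-∀
      lem₂ : ∀ a b x → (b - x) + (a - b) ≡ a - x
      lem₂ = solve-∀

    *-periodic : ∀ {f g} → Periodic f → Periodic g → Periodic (λ z → f z * g z)
    *-periodic pf pg a b d = cong₂ _*_ (pf a b d) (pg a b d)

    ∑-periodic : ∀ {f : A → ℤ → ℤ} → (∀ x → Periodic (f x)) → ∀ xs → Periodic (λ z → ∑[ x ∈ xs ] f x z)
    ∑-periodic pf xs a b d = ∑-cong (λ x → pf x a b d) xs

    affine-periodic : ∀ {f} → Periodic f → ∀ k t → Periodic (λ z → f (k * z + t))
    affine-periodic pf k t a b d = pf _ _ (∣-multiple k (lem k t a b) d)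
      where
      lem : ∀ k t a b → (k * a + t) - (k * b + t) ≡ k * (a - b)
      lem = solve-∀

    ≗-periodic : ∀ {f g} → (∀ z → g z ≡ f z) → Periodic f → Periodic g
    ≗-periodic g≗f pf a b d = trans (g≗f a) (trans (pf a b d) (sym (g≗f b)))

    shift-periodic : ∀ {f} → Periodic f → ∀ t → Periodic (λ z → f (z + t))
    shift-periodic {f} pf t = ≗-periodic (λ z → cong (λ s → f (s + t)) (sym (*-identityˡ z))) (affine-periodic pf 1ℤ t)

    scale-periodic : ∀ {f} → Periodic f → ∀ k → Periodic (λ z → f (k * z))
    scale-periodic {f} pf k = ≗-periodic (λ z → cong f (sym (+-identityʳ (k * z)))) (affine-periodic pf k 0ℤ)

    residues : List ℕ
    residues = downFrom p

    ∮ : (ℤ → ℤ) → ℤ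
    ∮ f = ∑[ i ∈ residues ] f (+ i)

    infix 5 ∮
    syntax ∮ (λ z → e) = ∮[ z ] e

    ∮-cong : ∀ {f g} → (∀ z → f z ≡ g z) → ∮ f ≡ ∮ g
    ∮-cong f≡g = ∑-cong (λ i → f≡g (+ i)) residues

    ∮-mono : ∀ {f g} → (∀ z → f z ≤ g z) → ∮ f ≤ ∮ g
    ∮-mono f≤g = ∑-mono (λ i → f≤g (+ i)) residues

    ∮-const : ∀ c → ∮[ z ] c ≡ P * c
    ∮-const c = trans (∑-const c residues) (cong (λ n → + n * c) (length-downFrom p))

    ∮-swap : ∀ (f : ℤ → ℤ → ℤ) → ∮[ z ] ∮[ w ] f z w ≡ ∮[ w ] ∮[ z ] f z w
    ∮-swap f = ∑-swap (λ i j → f (+ i) (+ j)) residues residues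

    ∮-*ˡ : ∀ c f → ∮[ z ] c * f z ≡ c * ∮ f
    ∮-*ˡ c f = ∑-*ˡ c (f ∘ +_) residues

    ∮-*ʳ : ∀ c f → ∮[ z ] f z * c ≡ ∮ f * c
    ∮-*ʳ c f = ∑-*ʳ c (f ∘ +_) residues

    ∮-*-∮ : ∀ f g → ∮[ z ] ∮[ w ] f z * g w ≡ ∮ f * ∮ g
    ∮-*-∮ f g = ∑-*-∑ (f ∘ +_) (g ∘ +_) residues residues

    ∮-nonNeg : ∀ {f} → (∀ z → 0ℤ ≤ f z) → 0ℤ ≤ ∮ f
    ∮-nonNeg 0≤f = ∑-nonNeg (λ i → 0≤f (+ i)) residues

    sift : ∀ {f} → Periodic f → ∀ a → ∮[ z ] δ (z - a) * f z ≡ f a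
    sift {f} pf a = trans (∑<-single p r (n%ℕd<d a p) others) (trans (cong₂ _*_ (ind-yes (P ∣? (+ r - a)) P∣r-a) (pf (+ r) a P∣r-a)) (*-identityˡ (f a)))
      where
      r : ℕ
      r = a %ℕ p
      P∣r-a : P ∣ + r - a
      P∣r-a = divides (- (a /ℕ p)) (trans (cong (λ s → + r - s) (a≡a%ℕn+[a/ℕn]*n a p)) (lem (+ r) (a /ℕ p) P))
        where
        lem : ∀ r q d → r - (r + q * d) ≡ - q * d
        lem = solve-∀
      others : ∀ i → i ℕ.< p → i ≢ r → δ (+ i - a) * f (+ i) ≡ 0ℤ
      others i i<p i≢r = trans (cong (_* f (+ i)) (ind-no (P ∣? (+ i - a)) λ d → i≢r (∣-small i<p (n%ℕd<d a p) (subst (P ∣_) (lem (+ i) a (+ r)) (∣m∣n⇒∣m-n d P∣r-a))))) (*-zeroˡ (f (+ i)))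
        where
        lem : ∀ i a r → (i - a) - (r - a) ≡ i - r
        lem = solve-∀

    ∮-δ : ∀ a → ∮[ z ] δ (z - a) ≡ 1ℤ
    ∮-δ a = trans (∮-cong (λ z → sym (*-identityʳ (δ (z - a))))) (sift (λ _ _ _ → refl) a)

    -- Change of variables by a permutation of the residues. The bijection enters only through `δ`,
    -- so ψ has to invert φ only modulo p, and neither map has to preserve the range of
    -- representatives.
    reindex : ∀ (φ ψ : ℤ → ℤ) → (∀ z w → δ (w - φ z) ≡ δ (z - ψ w)) → ∀ {f} → Periodic f → ∮[ z ] f (φ z) ≡ ∮ f
    reindex φ ψ adj {f} pf = begin
      ∮[ z ] f (φ z)                        ≡⟨ ∮-cong (λ z → sym (sift pf (φ z))) ⟩
      ∮[ z ] ∮[ w ] δ (w - φ z) * f w       ≡⟨ ∮-swap (λ z w → δ (w - φ z) * f w) ⟩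
      ∮[ w ] ∮[ z ] δ (w - φ z) * f w       ≡⟨ ∮-cong (λ w → ∮-cong (λ z → cong (_* f w) (adj z w))) ⟩
      ∮[ w ] ∮[ z ] δ (z - ψ w) * f w       ≡⟨ ∮-cong (λ w → ∮-*ʳ (f w) (λ z → δ (z - ψ w))) ⟩
      ∮[ w ] (∮[ z ] δ (z - ψ w)) * f w     ≡⟨ ∮-cong (λ w → trans (cong (_* f w) (∮-δ (ψ w))) (*-identityˡ (f w))) ⟩
      ∮ f                                   ∎
      where open ≡-Reasoning

    ∮-shift : ∀ {f} → Periodic f → ∀ t → ∮[ z ] f (z + t) ≡ ∮ f
    ∮-shift pf t = reindex (λ z → z + t) (λ w → w - t) (λ z w → δ-neg (lem z w t)) pf
      where
      lem : ∀ z w t → z - (w - t) ≡ - (w - (z + t))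
      lem = solve-∀

    ∮-reflect : ∀ {f} → Periodic f → ∀ t → ∮[ z ] f (t - z) ≡ ∮ f
    ∮-reflect pf t = reindex (λ z → t - z) (λ w → t - w) (λ z w → cong δ (lem z w t)) pf
      where
      lem : ∀ z w t → w - (t - z) ≡ z - (t - w)
      lem = solve-∀

    ∮-scale : ∀ {f} → Periodic f → ∀ u → ¬ P ∣ + u → ∮[ z ] f (+ u * z) ≡ ∮ f
    ∮-scale pf u p∤u with inverse u p∤u
    ... | v , P∣vu-1 = reindex (λ z → + u * z) (λ w → v * w) adj pf
      where
      lem₁ : ∀ u v w z → - v * (w - u * z) - z * (v * u - 1ℤ) ≡ z - v * w
      lem₁ = solve-∀
      lem₂ : ∀ u v w z → - u * (z - v * w) - w * (v * u - 1ℤ) ≡ w - u * z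
      lem₂ = solve-∀
      adj : ∀ z w → δ (w - + u * z) ≡ δ (z - v * w)
      adj z w = δ-cong
        (λ d → subst (P ∣_) (lem₁ (+ u) v w z) (∣m∣n⇒∣m-n (∣n⇒∣m*n (- v) d) (∣n⇒∣m*n z P∣vu-1)))
        (λ d → subst (P ∣_) (lem₂ (+ u) v w z) (∣m∣n⇒∣m-n (∣n⇒∣m*n (- u′) d) (∣n⇒∣m*n w P∣vu-1)))
        where u′ = + u

    -- Autocorrelation of a balanced function

    module Correlation (h : ℤ → ℤ) (h-periodic : Periodic h) (h-balanced : ∮ h ≡ 0ℤ) where

      c : ℤ → ℤ
      c t = ∮[ z ] h z * h (z + t)

      c-periodic : Periodic c
      c-periodic a b d = ∮-cong λ z → cong (h z *_) (h-periodic (z + a) (z + b) (∣-multiple 1ℤ (lem z a b) d))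
        where
        lem : ∀ z a b → (z + a) - (z + b) ≡ 1ℤ * (a - b)
        lem = solve-∀

      c-balanced : ∮ c ≡ 0ℤ
      c-balanced = begin
        ∮[ t ] ∮[ z ] h z * h (z + t)   ≡⟨ ∮-swap (λ t z → h z * h (z + t)) ⟩
        ∮[ z ] ∮[ t ] h z * h (z + t)   ≡⟨ ∮-cong (λ z → ∮-*ˡ (h z) (λ t → h (z + t))) ⟩
        ∮[ z ] h z * (∮[ t ] h (z + t)) ≡⟨ ∮-cong (λ z → cong (h z *_) (trans (∮-cong (λ t → cong h (+-comm z t))) (trans (∮-shift h-periodic z) h-balanced))) ⟩
        ∮[ z ] h z * 0ℤ                 ≡⟨ ∮-*ʳ 0ℤ h ⟩
        ∮ h * 0ℤ                        ≡⟨ *-zeroʳ (∮ h) ⟩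
        0ℤ                              ∎
        where open ≡-Reasoning

      c₀ : ℤ
      c₀ = ∮[ z ] h z * h z

      c≤c₀ : ∀ t → c t ≤ c₀
      c≤c₀ t = *-cancelˡ-≤-pos (c t) c₀ (+ 2) (subst₂ _≤_ (∮-*ˡ (+ 2) (λ z → h z * h (z + t))) total (∮-mono (λ z → amgm (h z) (h (z + t)))))
        where
        amgm : ∀ a b → + 2 * (a * b) ≤ a * a + b * b
        amgm a b = 0≤i-j⇒j≤i (subst (0ℤ ≤_) (lem a b) (0≤-square (a - b)))
          where
          lem : ∀ a b → (a - b) * (a - b) ≡ a * a + b * b - + 2 * (a * b)
          lem = solve-∀
        double : ∀ a → a + a ≡ + 2 * a
        double = solve-∀
        total : ∮[ z ] (h z * h z + h (z + t) * h (z + t)) ≡ + 2 * c₀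
        total = trans (∑-+ (λ i → h (+ i) * h (+ i)) (λ i → h (+ i + t) * h (+ i + t)) residues)
                      (trans (+-congʳ c₀ (∮-shift (*-periodic h-periodic h-periodic) t)) (double c₀))

      D : ℤ → ℤ
      D ρ = ∮[ w ] c w * c (ρ * w)

      D-periodic : Periodic D
      D-periodic a b d = ∮-cong λ w → cong (c w *_) (c-periodic (a * w) (b * w) (∣-multiple w (lem a b w) d))
        where
        lem : ∀ a b w → a * w - b * w ≡ w * (a - b)
        lem = solve-∀

      -- `D ρ` is a sum of squares: with `g s` the correlation of h with its dilate by ρ, opening
      -- `g s * g s` and summing over s first leaves `c (ρ * (y - z))`, and grouping by w = y - z
      -- gives the other factor `c w`. This is the elementary form of c having a nonnegative Fourier
      -- transform.
      D-nonNeg : ∀ ρ → 0ℤ ≤ D ρ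
      D-nonNeg ρ = subst (0ℤ ≤_) eq (∮-nonNeg (λ s → 0≤-square (g s)))
        where
        g : ℤ → ℤ
        g s = ∮[ z ] h z * h (s + ρ * z)
        medial : ∀ a b c d → (a * b) * (c * d) ≡ (a * c) * (b * d)
        medial = solve-∀
        inner : ∀ z y → ∮[ s ] h (s + ρ * z) * h (s + ρ * y) ≡ c (ρ * (y - z))
        inner z y = trans (∮-cong (λ s → cong (λ r → h (s + ρ * z) * h r) (lem s ρ y z)))
                          (∮-shift (*-periodic h-periodic (shift-periodic h-periodic (ρ * (y - z)))) (ρ * z))
          where
          lem : ∀ s ρ y z → s + ρ * y ≡ (s + ρ * z) + ρ * (y - z)
          lem = solve-∀
        G : ℤ → ℤ → ℤ
        G z y = (h z * h y) * c (ρ * (y - z))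
        G-periodic : ∀ z → Periodic (G z)
        G-periodic z = *-periodic (λ a b d → cong (h z *_) (h-periodic a b d))
                                  (λ a b d → c-periodic (ρ * (a - z)) (ρ * (b - z)) (∣-multiple ρ (lem ρ a b z) d))
          where
          lem : ∀ ρ a b z → ρ * (a - z) - ρ * (b - z) ≡ ρ * (a - b)
          lem = solve-∀
        cancel : ∀ w z → (w + z) - z ≡ w
        cancel = solve-∀
        open ≡-Reasoning
        eq : ∮[ s ] g s * g s ≡ D ρ
        eq = begin
          ∮[ s ] g s * g s
            ≡⟨ ∮-cong (λ s → sym (∮-*-∮ (λ z → h z * h (s + ρ * z)) (λ y → h y * h (s + ρ * y)))) ⟩
          ∮[ s ] ∮[ z ] ∮[ y ] (h z * h (s + ρ * z)) * (h y * h (s + ρ * y))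
            ≡⟨ ∮-swap (λ s z → ∮[ y ] (h z * h (s + ρ * z)) * (h y * h (s + ρ * y))) ⟩
          ∮[ z ] ∮[ s ] ∮[ y ] (h z * h (s + ρ * z)) * (h y * h (s + ρ * y))
            ≡⟨ ∮-cong (λ z → ∮-swap (λ s y → (h z * h (s + ρ * z)) * (h y * h (s + ρ * y)))) ⟩
          ∮[ z ] ∮[ y ] ∮[ s ] (h z * h (s + ρ * z)) * (h y * h (s + ρ * y))
            ≡⟨ ∮-cong (λ z → ∮-cong (λ y → ∮-cong (λ s → medial (h z) (h (s + ρ * z)) (h y) (h (s + ρ * y))))) ⟩
          ∮[ z ] ∮[ y ] ∮[ s ] (h z * h y) * (h (s + ρ * z) * h (s + ρ * y))
            ≡⟨ ∮-cong (λ z → ∮-cong (λ y → trans (∮-*ˡ (h z * h y) (λ s → h (s + ρ * z) * h (s + ρ * y))) (cong ((h z * h y) *_) (inner z y)))) ⟩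
          ∮[ z ] ∮[ y ] G z y
            ≡⟨ ∮-cong (λ z → sym (∮-shift (G-periodic z) z)) ⟩
          ∮[ z ] ∮[ w ] G z (w + z)
            ≡⟨ ∮-cong (λ z → ∮-cong (λ w → cong₂ (λ a b → (h z * h a) * c (ρ * b)) (+-comm w z) (cancel w z))) ⟩
          ∮[ z ] ∮[ w ] (h z * h (z + w)) * c (ρ * w)
            ≡⟨ ∮-swap (λ z w → (h z * h (z + w)) * c (ρ * w)) ⟩
          ∮[ w ] ∮[ z ] (h z * h (z + w)) * c (ρ * w)
            ≡⟨ ∮-cong (λ w → ∮-*ʳ (c (ρ * w)) (λ z → h z * h (z + w))) ⟩
          ∮[ w ] c w * c (ρ * w) ∎

      c-zero : ∀ {t} → P ∣ t → c t ≡ c₀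
      c-zero {t} d = ∮-cong λ z → cong (h z *_) (h-periodic (z + t) z (∣-multiple 1ℤ (lem z t) d))
        where
        lem : ∀ z t → (z + t) - z ≡ 1ℤ * t
        lem = solve-∀

      ∮-D : ∮ D ≡ P * (c₀ * c₀)
      ∮-D = begin
        ∮[ ρ ] ∮[ w ] c w * c (ρ * w)   ≡⟨ ∮-swap (λ ρ w → c w * c (ρ * w)) ⟩
        ∮[ w ] ∮[ ρ ] c w * c (ρ * w)   ≡⟨ ∮-cong (λ w → ∮-*ˡ (c w) (λ ρ → c (ρ * w))) ⟩
        ∮[ w ] c w * (∮[ ρ ] c (ρ * w)) ≡⟨ ∑-cong (λ i → trans (cong (c (+ i) *_) (inner i)) (rearrange (c (+ i)) (δ (+ i - 0ℤ)) P c₀)) residues ⟩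
        ∮[ w ] δ (w - 0ℤ) * (c w * (P * c₀)) ≡⟨ sift {λ w → c w * (P * c₀)} (*-periodic c-periodic (λ _ _ _ → refl)) 0ℤ ⟩
        c 0ℤ * (P * c₀)                 ≡⟨ cong (_* (P * c₀)) (c-zero (divides 0ℤ refl)) ⟩
        c₀ * (P * c₀)                   ≡⟨ rearrange′ c₀ P ⟩
        P * (c₀ * c₀)                   ∎
        where
        open ≡-Reasoning
        rearrange : ∀ a b c d → a * (b * (c * d)) ≡ b * (a * (c * d))
        rearrange = solve-∀
        rearrange′ : ∀ a b → a * (b * a) ≡ b * (a * a)
        rearrange′ = solve-∀
        -- For w prime to p, ρ ↦ ρ w permutes the residues and c sums to zero; for w = 0 every term
        -- is `c₀`. Writing the result with a `δ` lets `sift` extract w = 0.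
        inner : ∀ w → ∮[ ρ ] c (ρ * + w) ≡ δ (+ w - 0ℤ) * (P * c₀)
        inner w with P ∣? (+ w - 0ℤ)
        ... | yes d = trans (∮-cong (λ ρ → c-zero (∣n⇒∣m*n ρ (subst (P ∣_) (+-identityʳ (+ w)) d)))) (trans (∮-const c₀) (sym (*-identityˡ (P * c₀))))
        ... | no ¬d = trans (∮-cong (λ ρ → cong c (*-comm ρ (+ w)))) (trans (∮-scale c-periodic w (λ d → ¬d (subst (P ∣_) (sym (+-identityʳ (+ w))) d))) (trans c-balanced (sym (*-zeroˡ (P * c₀)))))

      -- Taking u w as the new variable shows that the correlation of two dilates depends only on
      -- the ratio ρ = u'/u. The ratio is specified by a congruence, so no division occurs.
      D-scale : ∀ u ρ → ¬ P ∣ + u → ∀ u′ → P ∣ u′ - ρ * + u → ∮[ w ] c (+ u * w) * c (u′ * w) ≡ D ρ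
      D-scale u ρ p∤u u′ d = trans
        (∮-cong (λ w → cong (c (+ u * w) *_) (c-periodic (u′ * w) (ρ * (+ u * w)) (∣-multiple w (lem u′ ρ (+ u) w) d))))
        (∮-scale (*-periodic c-periodic (scale-periodic c-periodic ρ)) u p∤u)
        where
        lem : ∀ u′ ρ u w → u′ * w - ρ * (u * w) ≡ w * (u′ - ρ * u)
        lem = solve-∀

  -- Indexed families of residues: counting functions and energies

  module Families (p : ℕ) (p-prime : Prime p) where

    open Residues p p-prime

    count : List A → (A → ℤ) → ℤ → ℤ
    count I x z = ∑[ i ∈ I ] δ (z - x i)

    -- Number of coincidences modulo p. For the family of all differences of v it is the additive
    -- energy of v.
    energy : List A → (A → ℤ) → ℤ
    energy I x = ∑[ i ∈ I ] ∑[ j ∈ I ] δ (x i - x j)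

    module _ (I : List A) (x : A → ℤ) where

      count-periodic : Periodic (count I x)
      count-periodic = ∑-periodic (λ i → δ-periodic (x i)) I

      count-nonNeg : ∀ z → 0ℤ ≤ count I x z
      count-nonNeg z = ∑-nonNeg (λ i → δ-nonNeg (z - x i)) I

      ∑-count : ∀ {f} → Periodic f → ∑[ i ∈ I ] f (x i) ≡ ∮[ z ] count I x z * f z
      ∑-count {f} pf = begin
        ∑[ i ∈ I ] f (x i)                       ≡⟨ ∑-cong (λ i → sym (sift pf (x i))) I ⟩
        ∑[ i ∈ I ] ∮[ z ] δ (z - x i) * f z      ≡⟨ ∑-swap (λ i k → δ (+ k - x i) * f (+ k)) I residues ⟩
        ∮[ z ] ∑[ i ∈ I ] δ (z - x i) * f z      ≡⟨ ∮-cong (λ z → ∑-*ʳ (f z) (λ i → δ (z - x i)) I) ⟩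
        ∮[ z ] count I x z * f z                 ∎
        where open ≡-Reasoning

      ∮-count : ∮ (count I x) ≡ + length I
      ∮-count = trans (∮-cong (λ z → sym (*-identityʳ (count I x z))))
               (trans (sym (∑-count {λ _ → 1ℤ} (λ _ _ _ → refl))) (trans (∑-const 1ℤ I) (*-identityʳ (+ length I))))

      energy-count : ∮[ z ] count I x z * count I x z ≡ energy I x
      energy-count = sym (∑-count count-periodic)

      -- Grouping the indices by residue turns the sum into the inner product of `count I x` with f,
      -- and the squared norm of `count I x` is the energy.
      energy-cauchy : ∀ {f} → Periodic f →
        (∑[ i ∈ I ] f (x i)) * (∑[ i ∈ I ] f (x i)) ≤ energy I x * (∮[ z ] f z * f z)
      energy-cauchy {f} pf = subst₂ _≤_ (cong (λ s → s * s) (sym (∑-count pf))) (cong (_* (∮[ z ] f z * f z)) energy-count)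
                                    (cauchy-schwarz (count I x ∘ +_) (f ∘ +_) residues)

      energy-nonNeg : 0ℤ ≤ energy I x
      energy-nonNeg = ∑-nonNeg (λ i → ∑-nonNeg (λ j → δ-nonNeg (x i - x j)) I) I

    module Balanced (I : List A) (x : A → ℤ) where

      n : ℤ
      n = + length I

      -- The mean of r is n / p; multiplying r minus its mean by p keeps h integral.
      r h : ℤ → ℤ
      r = count I x
      h z = P * r z - n

      h-periodic : Periodic h
      h-periodic a b d = cong (λ s → P * s - n) (count-periodic I x a b d)

      ∮-h-* : ∀ g → ∮[ z ] h z * g z ≡ P * (∮[ z ] r z * g z) - n * ∮ g
      ∮-h-* g = begin
        ∮[ z ] h z * g z                                    ≡⟨ ∮-cong (λ z → lem P (r z) n (g z)) ⟩
        ∮[ z ] (P * (r z * g z) + - n * g z)                ≡⟨ ∑-+ (λ i → P * (r (+ i) * g (+ i))) (λ i → - n * g (+ i)) residues ⟩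
        (∮[ z ] P * (r z * g z)) + (∮[ z ] - n * g z)       ≡⟨ cong₂ _+_ (∮-*ˡ P (λ z → r z * g z)) (∮-*ˡ (- n) g) ⟩
        P * (∮[ z ] r z * g z) + - n * ∮ g                  ≡⟨ +-congʳ (P * (∮[ z ] r z * g z)) (sym (neg-distribˡ-* n (∮ g))) ⟩
        P * (∮[ z ] r z * g z) - n * ∮ g                    ∎
        where
        open ≡-Reasoning
        lem : ∀ P r n g → (P * r - n) * g ≡ P * (r * g) + - n * g
        lem = solve-∀

      h-balanced : ∮ h ≡ 0ℤ
      h-balanced = begin
        ∮ h                                     ≡⟨ ∮-cong (λ z → sym (*-identityʳ (h z))) ⟩
        ∮[ z ] h z * 1ℤ                         ≡⟨ ∮-h-* (λ _ → 1ℤ) ⟩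
        P * (∮[ z ] r z * 1ℤ) - n * (∮[ z ] 1ℤ) ≡⟨ cong₂ (λ a b → P * a - n * b) (trans (∮-cong (λ z → *-identityʳ (r z))) (∮-count I x)) (∮-const 1ℤ) ⟩
        P * n - n * (P * 1ℤ)                    ≡⟨ lem P n ⟩
        0ℤ                                      ∎
        where
        open ≡-Reasoning
        lem : ∀ P n → P * n - n * (P * 1ℤ) ≡ 0ℤ
        lem = solve-∀

      open Correlation h h-periodic h-balanced public

      s : ℤ → ℤ
      s t = ∮[ z ] r z * r (z + t)

      c-expand : ∀ t → c t ≡ P * (P * s t - n * n)
      c-expand t = begin
        ∮[ z ] h z * h (z + t)
          ≡⟨ ∮-h-* (λ z → h (z + t)) ⟩
        P * (∮[ z ] r z * h (z + t)) - n * (∮[ z ] h (z + t))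
          ≡⟨ cong₂ (λ a b → P * a - n * b) inner (trans (∮-shift h-periodic t) h-balanced) ⟩
        P * (P * s t - n * n) - n * 0ℤ
          ≡⟨ lem (P * (P * s t - n * n)) n ⟩
        P * (P * s t - n * n) ∎
        where
        open ≡-Reasoning
        lem : ∀ a n → a - n * 0ℤ ≡ a
        lem = solve-∀
        lem′ : ∀ r P r′ n → r * (P * r′ - n) ≡ P * (r * r′) + - n * r
        lem′ = solve-∀
        lem″ : ∀ a n → a + - n * n ≡ a - n * n
        lem″ = solve-∀
        inner : ∮[ z ] r z * h (z + t) ≡ P * s t - n * n
        inner = begin
          ∮[ z ] r z * h (z + t)                               ≡⟨ ∮-cong (λ z → lem′ (r z) P (r (z + t)) n) ⟩
          ∮[ z ] (P * (r z * r (z + t)) + - n * r z)           ≡⟨ ∑-+ (λ i → P * (r (+ i) * r (+ i + t))) (λ i → - n * r (+ i)) residues ⟩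
          (∮[ z ] P * (r z * r (z + t))) + (∮[ z ] - n * r z)  ≡⟨ cong₂ _+_ (∮-*ˡ P (λ z → r z * r (z + t))) (trans (∮-*ˡ (- n) r) (cong (- n *_) (∮-count I x))) ⟩
          P * s t + - n * n                                    ≡⟨ lem″ (P * s t) n ⟩
          P * s t - n * n                                      ∎

      c₀≤ : c₀ ≤ P * P * energy I x
      c₀≤ = ≤-trans (≤-reflexive (trans (sym (c-zero (divides 0ℤ refl))) (trans (c-expand 0ℤ) (cong (λ a → P * (P * a - n * n)) s₀))))
                    (≤-trans (*-monoˡ P 0≤-pos (i≤j⇒i-k≤j (n * n) {{nonNeg}} ≤-refl)) (≤-reflexive (sym (*-assoc P P (energy I x)))))
        where
        nonNeg = nonNegative (0≤-square n)
        s₀ : s 0ℤ ≡ energy I x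
        s₀ = trans (∮-cong (λ z → cong (λ w → r z * r w) (+-identityʳ z))) (energy-count I x)

      ∮-s : ∮ s ≡ n * n
      ∮-s = begin
        ∮[ t ] ∮[ z ] r z * r (z + t)   ≡⟨ ∮-swap (λ t z → r z * r (z + t)) ⟩
        ∮[ z ] ∮[ t ] r z * r (z + t)   ≡⟨ ∮-cong (λ z → ∮-*ˡ (r z) (λ t → r (z + t))) ⟩
        ∮[ z ] r z * (∮[ t ] r (z + t)) ≡⟨ ∮-cong (λ z → cong (r z *_) (trans (∮-cong (λ t → cong r (+-comm z t))) (trans (∮-shift (count-periodic I x) z) (∮-count I x)))) ⟩
        ∮[ z ] r z * n                  ≡⟨ trans (∮-*ʳ n r) (cong (_* n) (∮-count I x)) ⟩
        n * n                           ∎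
        where open ≡-Reasoning

      -- Expand one of the two factors by `c-expand`. Its constant part pairs with the other factor
      -- to zero, since c is balanced; in the rest s is nonnegative with total n², so c may be
      -- replaced by its maximum `c₀`.
      ∮-c² : ∮[ w ] c w * c w ≤ P * P * (n * n) * c₀
      ∮-c² = begin
        ∮[ w ] c w * c w
          ≡⟨ ∮-cong (λ w → trans (cong (c w *_) (c-expand w)) (lem (c w) P (s w) n)) ⟩
        ∮[ w ] (P * P * (s w * c w) + - (P * (n * n)) * c w)
          ≡⟨ ∑-+ (λ i → P * P * (s (+ i) * c (+ i))) (λ i → - (P * (n * n)) * c (+ i)) residues ⟩
        (∮[ w ] P * P * (s w * c w)) + (∮[ w ] - (P * (n * n)) * c w)
          ≡⟨ cong₂ _+_ (∮-*ˡ (P * P) (λ w → s w * c w)) (trans (∮-*ˡ (- (P * (n * n))) c) (trans (cong (- (P * (n * n)) *_) c-balanced) (*-zeroʳ (- (P * (n * n)))))) ⟩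
        P * P * (∮[ w ] s w * c w) + 0ℤ
          ≡⟨ +-identityʳ (P * P * (∮[ w ] s w * c w)) ⟩
        P * P * (∮[ w ] s w * c w)
          ≤⟨ *-monoˡ (P * P) (0≤-square P) (∮-mono (λ w → *-monoˡ (s w) (∮-nonNeg (λ z → 0≤* (count-nonNeg I x z) (count-nonNeg I x (z + w)))) (c≤c₀ w))) ⟩
        P * P * (∮[ w ] s w * c₀)
          ≡⟨ cong (P * P *_) (trans (∮-*ʳ c₀ s) (cong (_* c₀) ∮-s)) ⟩
        P * P * (n * n * c₀)
          ≡⟨ sym (*-assoc (P * P) (n * n) c₀) ⟩
        P * P * (n * n) * c₀ ∎
        where
        open ≤-Reasoning
        lem : ∀ a P s n → a * (P * (P * s - n * n)) ≡ P * P * (s * a) + - (P * (n * n)) * a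
        lem = solve-∀

    difference : (A → ℤ) → A × A → ℤ
    difference v (a , b) = v a - v b

    -- Consequences of a residue avoided by u v + x + y

    module Bilinear
      (I : List A) (x : A → ℤ) (J : List B) (y : B → ℤ)
      (U : List C) (u : C → ℤ) (V : List E) (v : E → ℤ) (target : ℤ)
      (unsolvable : ∀ i j k l → ¬ P ∣ target - y j - u k * v l - x i) where

      open Balanced I x

      ψ : C → ℤ → ℤ
      ψ k z = ∑[ l ∈ V ] h (target - z - u k * v l)

      Φ : ℤ → ℤ
      Φ z = ∑[ k ∈ U ] ψ k z

      Cᵤ : ℤ → ℤ
      Cᵤ w = ∑[ k ∈ U ] c (u k * w)

      W : ℤ
      W = ∑[ d ∈ cartesianProduct V V ] Cᵤ (difference v d)

      h-arg-periodic : ∀ m → Periodic (λ z → h (target - z - m))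
      h-arg-periodic m a b d = h-periodic (target - a - m) (target - b - m) (∣-multiple (- 1ℤ) (lem target a b m) d)
        where
        lem : ∀ t a b m → (t - a - m) - (t - b - m) ≡ - 1ℤ * (a - b)
        lem = solve-∀

      Φ-periodic : Periodic Φ
      Φ-periodic = ∑-periodic (λ k → ∑-periodic (λ l → h-arg-periodic (u k * v l)) V) U

      -- By `unsolvable` no x lies at `target - y j - u k * v l`, so r vanishes there and h takes
      -- its least possible value.
      Φ-value : ∀ j → Φ (y j) ≡ + length U * (+ length V * - n)
      Φ-value j = trans (∑-cong (λ k → trans (∑-cong (λ l → value k l) V) (∑-const (- n) V)) U) (∑-const (+ length V * - n) U)
        where
        lem : ∀ P n → P * 0ℤ - n ≡ - n
        lem = solve-∀
        value : ∀ k l → h (target - y j - u k * v l) ≡ - n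
        value k l = trans (cong (λ a → P * a - n) (trans (∑-cong (λ i → ind-no (P ∣? (target - y j - u k * v l - x i)) (unsolvable i j k l)) I) (∑-zero I))) (lem P n)

      ∮-ψ² : ∀ k → ∮[ z ] ψ k z * ψ k z ≡ ∑[ l ∈ V ] ∑[ m ∈ V ] c (u k * (v l - v m))
      ∮-ψ² k = begin
        ∮[ z ] ψ k z * ψ k z
          ≡⟨ ∮-cong (λ z → sym (∑-*-∑ (λ l → h (target - z - u k * v l)) (λ m → h (target - z - u k * v m)) V V)) ⟩
        ∮[ z ] ∑[ l ∈ V ] ∑[ m ∈ V ] h (target - z - u k * v l) * h (target - z - u k * v m)
          ≡⟨ ∑-swap (λ i l → ∑[ m ∈ V ] h (target - + i - u k * v l) * h (target - + i - u k * v m)) residues V ⟩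
        ∑[ l ∈ V ] ∮[ z ] ∑[ m ∈ V ] h (target - z - u k * v l) * h (target - z - u k * v m)
          ≡⟨ ∑-cong (λ l → ∑-swap (λ i m → h (target - + i - u k * v l) * h (target - + i - u k * v m)) residues V) V ⟩
        ∑[ l ∈ V ] ∑[ m ∈ V ] ∮[ z ] h (target - z - u k * v l) * h (target - z - u k * v m)
          ≡⟨ ∑-cong (λ l → ∑-cong (λ m → inner l m) V) V ⟩
        ∑[ l ∈ V ] ∑[ m ∈ V ] c (u k * (v l - v m)) ∎
        where
        open ≡-Reasoning
        lem₁ : ∀ t z a b → t - z - a * b ≡ (t - a * b) - z
        lem₁ = solve-∀
        lem₂ : ∀ t z a b c → t - z - a * c ≡ ((t - a * b) - z) + a * (b - c)
        lem₂ = solve-∀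
        inner : ∀ l m → ∮[ z ] h (target - z - u k * v l) * h (target - z - u k * v m) ≡ c (u k * (v l - v m))
        inner l m = trans
          (∮-cong (λ z → cong₂ (λ a b → h a * h b) (lem₁ target z (u k) (v l)) (lem₂ target z (u k) (v l) (v m))))
          (∮-reflect (*-periodic h-periodic (shift-periodic h-periodic (u k * (v l - v m)))) (target - u k * v l))

      -- Cauchy-Schwarz over U alone: only terms with the same u meet, so what remains are
      -- correlations of the form `c (u k * (v l - v m))`, which see V only through its differences.
      ∮-Φ² : ∮[ z ] Φ z * Φ z ≤ + length U * W
      ∮-Φ² = begin
        ∮[ z ] Φ z * Φ z
          ≤⟨ ∮-mono (λ z → square-∑ (λ k → ψ k z) U) ⟩
        ∮[ z ] + length U * (∑[ k ∈ U ] ψ k z * ψ k z)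
          ≡⟨ ∮-*ˡ (+ length U) (λ z → ∑[ k ∈ U ] ψ k z * ψ k z) ⟩
        + length U * (∮[ z ] ∑[ k ∈ U ] ψ k z * ψ k z)
          ≡⟨ cong (+ length U *_) (trans (∑-swap (λ i k → ψ k (+ i) * ψ k (+ i)) residues U) (∑-cong ∮-ψ² U)) ⟩
        + length U * (∑[ k ∈ U ] ∑[ l ∈ V ] ∑[ m ∈ V ] c (u k * (v l - v m)))
          ≡⟨ cong (+ length U *_) (trans (∑-swap (λ k l → ∑[ m ∈ V ] c (u k * (v l - v m))) U V) (∑-cong (λ l → ∑-swap (λ k m → c (u k * (v l - v m))) U V) V)) ⟩
        + length U * (∑[ l ∈ V ] ∑[ m ∈ V ] Cᵤ (v l - v m))
          ≡⟨ cong (+ length U *_) (sym (∑-product (Cᵤ ∘ difference v) _,_ V V)) ⟩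
        + length U * W ∎
        where open ≤-Reasoning

      -- Φ has the same large negative value at every `y j`; `energy-cauchy` for y compares the sum
      -- of these values with the full norm of Φ.
      first-bound : let M = + length J * (+ length U * (+ length V * n)) in
                    M * M ≤ energy J y * (+ length U * W)
      first-bound = ≤-trans
        (≤-reflexive (sym (trans (cong (λ a → a * a) (trans (∑-cong Φ-value J) (∑-const (+ length U * (+ length V * - n)) J))) (lem (+ length J) (+ length U) (+ length V) n))))
        (≤-trans (energy-cauchy J y Φ-periodic) (*-monoˡ (energy J y) (energy-nonNeg J y) ∮-Φ²))
        where
        lem : ∀ a b c d → (a * (b * (c * - d))) * (a * (b * (c * - d))) ≡ (a * (b * (c * d))) * (a * (b * (c * d)))
        lem = solve-∀

      U*W-nonNeg : 0ℤ ≤ + length U * W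
      U*W-nonNeg = ≤-trans (∮-nonNeg (λ z → 0≤-square (Φ z))) ∮-Φ²

      -- When the u are prime to p, each inner sum is D at the ratio u j / u i, by `D-scale`.
      S : ℤ
      S = ∑[ i ∈ U ] ∑[ j ∈ U ] ∮[ w ] c (u i * w) * c (u j * w)

      ∮-Cᵤ² : ∮[ w ] Cᵤ w * Cᵤ w ≡ S
      ∮-Cᵤ² = trans (∮-cong (λ w → sym (∑-*-∑ (λ i → c (u i * w)) (λ j → c (u j * w)) U U)))
             (trans (∑-swap (λ k i → ∑[ j ∈ U ] c (u i * + k) * c (u j * + k)) residues U)
                    (∑-cong (λ i → ∑-swap (λ k j → c (u i * + k) * c (u j * + k)) residues U) U))

      S-nonNeg : 0ℤ ≤ S
      S-nonNeg = ≤-trans (∮-nonNeg (λ w → 0≤-square (Cᵤ w))) (≤-reflexive ∮-Cᵤ²)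

      -- `W` is the sum of `Cᵤ` over the family of differences of V, so `energy-cauchy` brings in
      -- the additive energy of V.
      second-bound : W * W ≤ energy (cartesianProduct V V) (difference v) * S
      second-bound = ≤-trans
        (energy-cauchy (cartesianProduct V V) (difference v) (∑-periodic (λ k → scale-periodic c-periodic (u k)) U))
        (≤-reflexive (cong (energy (cartesianProduct V V) (difference v) *_) ∮-Cᵤ²))

  -- Polynomial functions

  -- f is a polynomial function of degree at most d with coefficient k at x^d:
  -- dividing by x - a lowers the degree and keeps the leading coefficient.
  Poly : ℕ → ℤ → (ℤ → ℤ) → Set
  Poly zero    k f = ∀ x → f x ≡ k
  Poly (suc d) k f = ∀ a → ∃[ g ] (Poly d k g × (∀ x → f x ≡ f a + (x - a) * g x))

  Poly-+ : ∀ d {k l f g} → Poly d k f → Poly d l g → Poly d (k + l) (λ x → f x + g x)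
  Poly-+ zero    pf pg x = cong₂ _+_ (pf x) (pg x)
  Poly-+ (suc d) {f = f} {g} pf pg a with pf a | pg a
  ... | f′ , pf′ , eqf | g′ , pg′ , eqg = (λ x → f′ x + g′ x) , Poly-+ d pf′ pg′ ,
          λ x → trans (cong₂ _+_ (eqf x) (eqg x)) (lem (f a) (g a) (x - a) (f′ x) (g′ x))
    where
    lem : ∀ a b y r s → (a + y * r) + (b + y * s) ≡ (a + b) + y * (r + s)
    lem = solve-∀

  Poly-scale : ∀ d m {k f} → Poly d k f → Poly d (m * k) (λ x → m * f x)
  Poly-scale zero    m pf x = cong (m *_) (pf x)
  Poly-scale (suc d) m {f = f} pf a with pf a
  ... | f′ , pf′ , eqf = (λ x → m * f′ x) , Poly-scale d m pf′ , λ x → trans (cong (m *_) (eqf x)) (lem m (f a) (x - a) (f′ x))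
    where
    lem : ∀ m a y r → m * (a + y * r) ≡ m * a + y * (m * r)
    lem = solve-∀

  Poly-raise : ∀ d {k f} → Poly d k f → Poly (suc d) 0ℤ f
  Poly-raise zero {k} {f} pf a = (λ _ → 0ℤ) , (λ _ → refl) , λ x → trans (trans (pf x) (sym (pf a))) (lem (f a) (x - a))
    where
    lem : ∀ b y → b ≡ b + y * 0ℤ
    lem = solve-∀
  Poly-raise (suc d) pf a with pf a
  ... | g , pg , eq = g , Poly-raise d pg , eq

  Poly-const : ∀ d k → Poly (suc d) 0ℤ (λ _ → k)
  Poly-const zero    k = Poly-raise zero (λ _ → refl)
  Poly-const (suc d) k = Poly-raise (suc d) (Poly-const d k)

  Poly-shift : ∀ d s {k f} → Poly d k f → Poly d k (λ x → f (s + x))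
  Poly-shift zero    s pf x = pf (s + x)
  Poly-shift (suc d) s {f = f} pf a with pf (s + a)
  ... | g , pg , eq = (λ x → g (s + x)) , Poly-shift d s pg , λ x → trans (eq (s + x)) (cong (λ y → f (s + a) + y * g (s + x)) (lem s x a))
    where
    lem : ∀ s x a → (s + x) - (s + a) ≡ x - a
    lem = solve-∀

  -- Split (x + s) f(x) as (x - a) f(x) + (a + s) f(x) and divide f by x - a in the second term
  -- only. The quotient is f + (a + s) g, and g, being of lower degree, leaves the leading
  -- coefficient of f unchanged.
  Poly-linear-* : ∀ d s {k f} → Poly d k f → Poly (suc d) k (λ x → (x + s) * f x)
  Poly-linear-* zero s {k} {f} pf a = f , pf , λ x → trans (cong ((x + s) *_) (pf x)) (trans (lem x a s k) (sym (cong₂ (λ y z → (a + s) * y + (x - a) * z) (pf a) (pf x))))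
    where
    lem : ∀ x a s k → (x + s) * k ≡ (a + s) * k + (x - a) * k
    lem = solve-∀
  Poly-linear-* (suc d) s {k} {f} pf a with pf a
  ... | g , pg , eq = (λ x → f x + (a + s) * g x) ,
          subst (λ l → Poly (suc d) l (λ x → f x + (a + s) * g x)) (lem₁ k (a + s)) (Poly-+ (suc d) pf (Poly-scale (suc d) (a + s) (Poly-raise d pg))) ,
          λ x → trans (lem₂ x s a (f x)) (trans (cong (λ y → (x - a) * f x + (a + s) * y) (eq x)) (lem₃ x a s (f x) (f a) (g x)))
    where
    lem₁ : ∀ k m → k + m * 0ℤ ≡ k
    lem₁ = solve-∀
    lem₂ : ∀ x s a y → (x + s) * y ≡ (x - a) * y + (a + s) * y
    lem₂ = solve-∀
    lem₃ : ∀ x a s y b r → (x - a) * y + (a + s) * (b + (x - a) * r) ≡ (a + s) * b + (x - a) * (y + (a + s) * r)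
    lem₃ = solve-∀

  -- The product (x + 1) ... (x + k), that is, (x + k)! / x!.
  rising : ℕ → ℤ → ℤ
  rising zero    x = 1ℤ
  rising (suc k) x = (x + + suc k) * rising k x

  Poly-rising : ∀ k → Poly k 1ℤ (rising k)
  Poly-rising zero    x = refl
  Poly-rising (suc k) = Poly-linear-* k (+ suc k) (Poly-rising k)

  factorial-rising : ∀ m k → + ((m ℕ.+ k) !) ≡ + (m !) * rising k (+ m)
  factorial-rising m zero    = trans (cong (λ a → + (a !)) (ℕ.+-identityʳ m)) (sym (*-identityʳ (+ (m !))))
  factorial-rising m (suc k) = begin
    + ((m ℕ.+ suc k) !)                            ≡⟨ cong (λ a → + (a !)) (ℕ.+-suc m k) ⟩
    + (suc (m ℕ.+ k) ℕ.* (m ℕ.+ k) !)              ≡⟨ pos-* (suc (m ℕ.+ k)) ((m ℕ.+ k) !) ⟩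
    + suc (m ℕ.+ k) * + ((m ℕ.+ k) !)              ≡⟨ cong₂ _*_ (cong +_ (sym (ℕ.+-suc m k))) (factorial-rising m k) ⟩
    + (m ℕ.+ suc k) * (+ (m !) * rising k (+ m))   ≡⟨ lem (+ m + + suc k) (+ (m !)) (rising k (+ m)) ⟩
    + (m !) * ((+ m + + suc k) * rising k (+ m))   ∎
    where
    open ≡-Reasoning
    lem : ∀ a b c → a * (b * c) ≡ b * (a * c)
    lem = solve-∀

  combination : ℕ → (ℕ → ℤ) → ℤ → ℤ
  combination M a x = ∑[ k ∈ downFrom M ] a k * rising k x

  -- The polynomials `rising k` are monic of degree k, so the last coefficient in this basis is the
  -- leading coefficient. The coarser bound `Poly-combination` serves for the lower terms in
  -- `Poly-leading`.
  Poly-combination : ∀ M a → Poly M 0ℤ (combination M a)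
  Poly-leading : ∀ M a → Poly M (a M) (combination (suc M) a)

  Poly-combination zero    a x = refl
  Poly-combination (suc M) a = Poly-raise M (Poly-leading M a)

  Poly-leading M a = subst (λ k → Poly M k (combination (suc M) a)) (lem (a M))
    (Poly-+ M (Poly-scale M (a M) (Poly-rising M)) (Poly-combination M a))
    where
    lem : ∀ k → k * 1ℤ + 0ℤ ≡ k
    lem = solve-∀

  -- Sums over `Fin n` and the Kronecker delta

  ∑-allFin-suc : ∀ n (f : Fin (suc n) → ℤ) → ∑ (allFin (suc n)) f ≡ f zero + ∑ (allFin n) (f ∘ suc)
  ∑-allFin-suc n f = +-congʳ (f zero) (trans (cong (λ xs → ∑ xs f) (sym (map-tabulate id suc))) (∑-map f suc (allFin n)))

  ι : ∀ {n} → Fin n → Fin n → ℤ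
  ι i j = ind (i Fin.≟ j)

  ∑-ι : ∀ {n} (i : Fin n) → ∑[ j ∈ allFin n ] ι i j ≡ 1ℤ
  ∑-ι {suc n} zero = trans (∑-allFin-suc n (ι zero)) (+-congʳ 1ℤ (trans (∑-cong (λ j → ind-no (zero Fin.≟ suc j) (λ ())) (allFin n)) (∑-zero (allFin n))))
  ∑-ι {suc n} (suc i) = trans (∑-allFin-suc n (ι (suc i)))
    (trans (+-identityˡ _) (trans (∑-cong (λ j → ind-cong (suc i Fin.≟ suc j) (i Fin.≟ j) Fin.suc-injective (cong suc)) (allFin n)) (∑-ι i)))

  length-allFin : ∀ n → length (allFin n) ≡ n
  length-allFin n = length-tabulate id

  ∑-allFin-const : ∀ n k → ∑[ i ∈ allFin n ] k ≡ + n * k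
  ∑-allFin-const n k = trans (∑-const k (allFin n)) (cong (λ m → + m * k) (length-allFin n))

  -- Roots modulo p of polynomials and of relations between factorials

  module Roots (p : ℕ) (p-prime : Prime p) where

    open Residues p p-prime

    P∤1 : ¬ P ∣ 1ℤ
    P∤1 d = contradiction (ℕ.∣⇒≤ (∣⇒∣ᵤ d)) (ℕ.<⇒≱ (ℕ.nonTrivial⇒n>1 p {{prime⇒nonTrivial p-prime}}))

    P∤! : ∀ m → m ℕ.< p → ¬ P ∣ + (m !)
    P∤! zero    m<p = P∤1
    P∤! (suc m) m<p d with euclidsLemma (suc m) (m !) p-prime (∣⇒∣ᵤ d)
    ... | inj₁ p∣1+m = contradiction (ℕ.∣⇒≤ p∣1+m) (ℕ.<⇒≱ m<p)
    ... | inj₂ p∣m!  = P∤! m (ℕ.<-trans (ℕ.n<1+n m) m<p) (∣ᵤ⇒∣ p∣m!)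

    -- Lagrange's bound, peeling off the largest root N: for i < N < p the difference i - N is prime
    -- to p, so every other root is a root of the quotient by x - N.
    roots : ∀ d {k f} → Poly d k f → ¬ P ∣ k → ∀ N → N ℕ.≤ p → ∑[ n ∈ downFrom N ] δ (f (+ n)) ≤ + d
    roots d    pf P∤k zero    N≤p = +≤+ ℕ.z≤n
    roots zero {k} {f} pf P∤k (suc N) N≤p = ≤-reflexive (trans (∑-cong (λ n → trans (cong δ (pf (+ n))) (ind-no (P ∣? k) P∤k)) (downFrom (suc N))) (∑-zero (downFrom (suc N))))
    roots (suc d) {k} {f} pf P∤k (suc N) N<p with P ∣? f (+ N)
    ... | no  _ = ≤-trans (≤-reflexive (+-identityˡ _)) (roots (suc d) pf P∤k N (ℕ.<⇒≤ N<p))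
    ... | yes P∣fN with pf (+ N)
    ...   | g , pg , eq = +-monoʳ-≤ 1ℤ (≤-trans (∑<-mono N step) (roots d pg P∤k N (ℕ.<⇒≤ N<p)))
      where
      step : ∀ i → i ℕ.< N → δ (f (+ i)) ≤ δ (g (+ i))
      step i i<N = δ-mono λ P∣fi → case (euclid (+ i - + N) (g (+ i)) (∣m+n∣m⇒∣n (subst (P ∣_) (eq (+ i)) P∣fi) P∣fN))
        where
        case : P ∣ + i - + N ⊎ P ∣ g (+ i) → P ∣ g (+ i)
        case (inj₁ d) = contradiction (∣-small (ℕ.<-trans i<N N<p) N<p d) (ℕ.<⇒≢ i<N)
        case (inj₂ d) = d

    -- Leading coefficients divisible by p are discarded one by one; the coefficient at j guarantees
    -- that this stops at a polynomial that is nonzero modulo p.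
    combination-roots : ∀ M a j → j ℕ.< M → ¬ P ∣ a j → ∀ s N → N ℕ.≤ p →
                        ∑[ n ∈ downFrom N ] δ (combination M a (s + + n)) ≤ + M
    combination-roots (suc M) a j j<1+M P∤aj s N N≤p with P ∣? a M
    ... | no P∤aM = ≤-trans (roots M (Poly-shift M s (Poly-leading M a)) P∤aM N N≤p) (+≤+ (ℕ.n≤1+n M))
    ... | yes P∣aM = ≤-trans (∑-mono (λ n → δ-mono (λ d → ∣m+n∣m⇒∣n d (∣m⇒∣m*n (rising M (s + + n)) P∣aM))) (downFrom N))
                    (≤-trans (combination-roots M a j (ℕ.≤∧≢⇒< (ℕ.s≤s⁻¹ j<1+M) (λ { refl → P∤aj P∣aM })) P∤aj s N N≤p) (+≤+ (ℕ.n≤1+n M)))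

    -- Dividing by (n + 1)!, which is prime to p because n < N < p, turns a linear relation between
    -- nearby factorials into a polynomial equation for n.
    factorial-roots : ∀ M a j → j ℕ.< M → ¬ P ∣ a j → ∀ N → N ℕ.< p →
                      ∑[ n ∈ downFrom N ] δ (∑[ k ∈ downFrom M ] a k * + ((suc n ℕ.+ k) !)) ≤ + M
    factorial-roots M a j j<M P∤aj N N<p = ≤-trans (∑<-mono N step) (combination-roots M a j j<M P∤aj 1ℤ N (ℕ.<⇒≤ N<p))
      where
      lem : ∀ a b c → a * (b * c) ≡ b * (a * c)
      lem = solve-∀
      factor : ∀ n → ∑[ k ∈ downFrom M ] a k * + ((suc n ℕ.+ k) !) ≡ + (suc n !) * combination M a (+ suc n)
      factor n = trans (∑-cong (λ k → trans (cong (a k *_) (factorial-rising (suc n) k)) (lem (a k) (+ (suc n !)) (rising k (+ suc n)))) (downFrom M))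
                       (∑-*ˡ (+ (suc n !)) (λ k → a k * rising k (+ suc n)) (downFrom M))
      step : ∀ n → n ℕ.< N → δ (∑[ k ∈ downFrom M ] a k * + ((suc n ℕ.+ k) !)) ≤ δ (combination M a (1ℤ + + n))
      step n n<N = δ-mono λ d → case (euclid (+ (suc n !)) (combination M a (+ suc n)) (subst (P ∣_) (factor n) d))
        where
        case : P ∣ + (suc n !) ⊎ P ∣ combination M a (+ suc n) → P ∣ combination M a (+ suc n)
        case (inj₁ d) = contradiction d (P∤! (suc n) (ℕ.≤-<-trans n<N N<p))
        case (inj₂ d) = d

    δ≤1 : ∀ z → δ z ≤ 1ℤ
    δ≤1 z = ind-≤1 (P ∣? z)

    ∑-δ≤ : ∀ (f : ℕ → ℤ) N → ∑[ n ∈ downFrom N ] δ (f n) ≤ + N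
    ∑-δ≤ f N = ≤-trans (∑-mono (λ n → δ≤1 (f n)) (downFrom N))
              (≤-reflexive (trans (∑-const 1ℤ (downFrom N)) (trans (*-identityʳ (+ length (downFrom N))) (cong +_ (length-downFrom N)))))

  -- Averages over the starting point of a block of factorials

  module Averages (p : ℕ) (p-prime : Prime p) where

    open Residues p p-prime
    open Families p p-prime
    open Roots p p-prime

    module Dilates (h : ℤ → ℤ) (h-periodic : Periodic h) (h-balanced : ∮ h ≡ 0ℤ) (G N : ℕ) (G+N≤p : G ℕ.+ N ℕ.≤ p) where

      open Correlation h h-periodic h-balanced

      N≤p : N ℕ.≤ p
      N≤p = ℕ.≤-trans (ℕ.m≤n+m N G) G+N≤p

      -- A monic polynomial of degree d + 1 takes each value ρ at most d + 1 times. As D is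
      -- nonnegative, this multiplicity can be inserted for every ρ, and `∮-D` evaluates the full
      -- sum.
      D-rising-average : ∀ d s → ∑[ n ∈ downFrom N ] D (rising (suc d) (s + + n)) ≤ + suc d * (P * (c₀ * c₀))
      D-rising-average d s = begin
        ∑[ n ∈ downFrom N ] D (f n)       ≡⟨ ∑-count (downFrom N) f D-periodic ⟩
        ∮[ ρ ] count (downFrom N) f ρ * D ρ ≤⟨ ∮-mono (λ ρ → *-monoʳ (D ρ) (D-nonNeg ρ) (few ρ)) ⟩
        ∮[ ρ ] + suc d * D ρ              ≡⟨ trans (∮-*ˡ (+ suc d) D) (cong (+ suc d *_) ∮-D) ⟩
        + suc d * (P * (c₀ * c₀))         ∎
        where
        open ≤-Reasoning
        f : ℕ → ℤ
        f n = rising (suc d) (s + + n)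
        lem : ∀ a b → a + - b ≡ - (b - a)
        lem = solve-∀
        few : ∀ ρ → count (downFrom N) f ρ ≤ + suc d
        few ρ = ≤-trans (≤-reflexive (∑-cong (λ n → δ-neg (lem (f n) ρ)) (downFrom N)))
                        (roots (suc d) (Poly-+ (suc d) (Poly-shift (suc d) s (Poly-rising (suc d))) (Poly-const d (- ρ))) P∤1 N N≤p)

      u : ℕ → Fin G → ℤ
      u n i = + (suc (toℕ i ℕ.+ n) !)

      T : ℕ → Fin G → Fin G → ℤ
      T n i j = ∮[ w ] c (u n i * w) * c (u n j * w)

      P∤u : ∀ n i → n ℕ.< N → ¬ P ∣ u n i
      P∤u n i n<N = P∤! (suc (toℕ i ℕ.+ n)) (ℕ.<-≤-trans (ℕ.+-mono-≤-< (Fin.toℕ<n i) n<N) G+N≤p)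

      -- The quotient of the factorials at j and i is the product of j - i = d + 1 consecutive
      -- integers.
      T-above : ∀ n i j d → n ℕ.< N → suc (toℕ i) ℕ.+ d ≡ toℕ j → T n i j ≡ D (rising (suc d) (+ suc (toℕ i) + + n))
      T-above n i j d n<N eq = D-scale (suc (toℕ i ℕ.+ n) !) (rising (suc d) (+ suc (toℕ i ℕ.+ n))) (P∤u n i n<N) (u n j)
        (divides 0ℤ (trans (cong (_- rising (suc d) (+ suc (toℕ i ℕ.+ n)) * u n i) uj) (cancel (u n i) (rising (suc d) (+ suc (toℕ i ℕ.+ n))))))
        where
        index : suc (toℕ j ℕ.+ n) ≡ suc (toℕ i ℕ.+ n) ℕ.+ suc d
        index = cong suc (begin
          toℕ j ℕ.+ n               ≡⟨ cong (ℕ._+ n) (sym eq) ⟩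
          suc (toℕ i ℕ.+ d) ℕ.+ n   ≡⟨ cong suc (ℕ.+-assoc (toℕ i) d n) ⟩
          suc (toℕ i ℕ.+ (d ℕ.+ n)) ≡⟨ cong (λ k → suc (toℕ i ℕ.+ k)) (ℕ.+-comm d n) ⟩
          suc (toℕ i ℕ.+ (n ℕ.+ d)) ≡⟨ cong suc (sym (ℕ.+-assoc (toℕ i) n d)) ⟩
          suc (toℕ i ℕ.+ n ℕ.+ d)   ≡⟨ sym (ℕ.+-suc (toℕ i ℕ.+ n) d) ⟩
          toℕ i ℕ.+ n ℕ.+ suc d     ∎)
          where open ≡-Reasoning
        uj : u n j ≡ u n i * rising (suc d) (+ suc (toℕ i ℕ.+ n))
        uj = trans (cong (λ k → + (k !)) index) (factorial-rising (suc (toℕ i ℕ.+ n)) (suc d))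
        cancel : ∀ a b → a * b - b * a ≡ 0ℤ
        cancel = solve-∀

      average-above : ∀ i j → toℕ i ℕ.< toℕ j → ∑[ n ∈ downFrom N ] T n i j ≤ + G * (P * (c₀ * c₀))
      average-above i j i<j with ℕ.m≤n⇒∃[o]m+o≡n i<j
      ... | d , eq = ≤-trans (≤-reflexive (∑<-cong N (λ n n<N → T-above n i j d n<N eq)))
                    (≤-trans (D-rising-average d (+ suc (toℕ i)))
                             (*-monoʳ (P * (c₀ * c₀)) (0≤* (0≤-pos {p}) (0≤-square c₀)) (+≤+ d<G)))
        where
        d<G : d ℕ.< G
        d<G = ℕ.≤-<-trans (subst (d ℕ.≤_) eq (ℕ.m≤n+m d (suc (toℕ i)))) (Fin.toℕ<n j)

      -- Each of the G diagonal pairs contributes at most N b, and each other pair, by symmetry in i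
      -- and j, at most `K`. Granting `K` to the diagonal as well gives one formula for all pairs.
      dilate-average : ∀ {b} → 0ℤ ≤ b → ∮[ w ] c w * c w ≤ b →
        ∑[ n ∈ downFrom N ] ∑[ i ∈ allFin G ] ∑[ j ∈ allFin G ] T n i j ≤ + G * (+ N * b + + G * (+ G * (P * (c₀ * c₀))))
      dilate-average {b} 0≤b c²≤b = begin
        ∑[ n ∈ downFrom N ] ∑[ i ∈ allFin G ] ∑[ j ∈ allFin G ] T n i j
          ≡⟨ trans (∑-swap (λ n i → ∑[ j ∈ allFin G ] T n i j) (downFrom N) (allFin G)) (∑-cong (λ i → ∑-swap (λ n j → T n i j) (downFrom N) (allFin G)) (allFin G)) ⟩
        ∑[ i ∈ allFin G ] ∑[ j ∈ allFin G ] ∑[ n ∈ downFrom N ] T n i j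
          ≤⟨ ∑-mono (λ i → ∑-mono (λ j → pair i j) (allFin G)) (allFin G) ⟩
        ∑[ i ∈ allFin G ] ∑[ j ∈ allFin G ] (ι i j * (+ N * b) + K)
          ≡⟨ ∑-cong (λ i → trans (∑-+ (λ j → ι i j * (+ N * b)) (λ _ → K) (allFin G))
                     (cong₂ _+_ (trans (∑-*ʳ (+ N * b) (ι i) (allFin G)) (trans (cong (_* (+ N * b)) (∑-ι i)) (*-identityˡ (+ N * b)))) (∑-allFin-const G K))) (allFin G) ⟩
        ∑[ i ∈ allFin G ] (+ N * b + + G * K)
          ≡⟨ ∑-allFin-const G (+ N * b + + G * K) ⟩
        + G * (+ N * b + + G * K) ∎
        where
        open ≤-Reasoning
        K : ℤ
        K = + G * (P * (c₀ * c₀))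
        0≤K : 0ℤ ≤ K
        0≤K = 0≤* (0≤-pos {G}) (0≤* (0≤-pos {p}) (0≤-square c₀))
        weaken : ∀ i j {a} → a ≤ K → a ≤ ι i j * (+ N * b) + K
        weaken i j {a} a≤K = ≤-trans (≤-reflexive (sym (+-identityˡ a))) (+-mono-≤ (0≤* (ind-nonNeg (i Fin.≟ j)) (0≤* (0≤-pos {N}) 0≤b)) a≤K)
        diagonal : ∀ n i → n ℕ.< N → T n i i ≤ b
        diagonal n i n<N = ≤-trans (≤-reflexive (trans (D-scale (suc (toℕ i ℕ.+ n) !) 1ℤ (P∤u n i n<N) (u n i) (divides 0ℤ (cancel (u n i))))
                                                       (∮-cong (λ w → cong (λ z → c w * c z) (*-identityˡ w))))) c²≤b
          where
          cancel : ∀ a → a - 1ℤ * a ≡ 0ℤ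
          cancel = solve-∀
        pair : ∀ i j → ∑[ n ∈ downFrom N ] T n i j ≤ ι i j * (+ N * b) + K
        pair i j with ℕ.<-cmp (toℕ i) (toℕ j)
        ... | tri< i<j _ _ = weaken i j (average-above i j i<j)
        ... | tri> _ _ j<i = weaken i j (≤-trans (≤-reflexive (∑-cong (λ n → ∮-cong (λ w → *-comm (c (u n i * w)) (c (u n j * w)))) (downFrom N))) (average-above j i j<i))
        ... | tri≈ _ i≡j _ with Fin.toℕ-injective i≡j
        ...   | refl = begin
          ∑[ n ∈ downFrom N ] T n i i    ≤⟨ ∑<-mono N (λ n → diagonal n i) ⟩
          ∑[ n ∈ downFrom N ] b          ≡⟨ trans (∑-const b (downFrom N)) (cong (λ m → + m * b) (length-downFrom N)) ⟩
          + N * b                        ≡⟨ sym (trans (cong (_* (+ N * b)) (ind-yes (i Fin.≟ i) refl)) (*-identityˡ (+ N * b))) ⟩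
          ι i i * (+ N * b)              ≡⟨ sym (+-identityʳ _) ⟩
          ι i i * (+ N * b) + 0ℤ         ≤⟨ +-monoʳ-≤ (ι i i * (+ N * b)) 0≤K ⟩
          ι i i * (+ N * b) + K          ∎

    unit : ℕ → ℕ → ℤ
    unit i k = ind (i ℕ.≟ k)

    unit-same : ∀ i → unit i i ≡ 1ℤ
    unit-same i = ind-yes (i ℕ.≟ i) refl

    unit-other : ∀ {i k} → i ≢ k → unit i k ≡ 0ℤ
    unit-other {i} {k} = ind-no (i ℕ.≟ k)

    unit-expand : ∀ {M i} (f : ℕ → ℤ) → i ℕ.< M → ∑[ k ∈ downFrom M ] unit i k * f k ≡ f i
    unit-expand {M} {i} f i<M = trans (∑<-single M i i<M (λ k _ k≢i → trans (cong (_* f k) (unit-other (k≢i ∘ sym))) (*-zeroˡ (f k))))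
                                      (trans (cong (_* f i) (unit-same i)) (*-identityˡ (f i)))

    module Block (M : ℕ) where

      v : ℕ → Fin M → ℤ
      v n i = + ((suc n ℕ.+ toℕ i) !)

      a : Fin M → Fin M → Fin M → Fin M → ℕ → ℤ
      a i j k l m = (unit (toℕ i) m - unit (toℕ j) m) - (unit (toℕ k) m - unit (toℕ l) m)

      v-expand : ∀ n i j k l → (v n i - v n j) - (v n k - v n l) ≡ ∑[ m ∈ downFrom M ] a i j k l m * + ((suc n ℕ.+ m) !)
      v-expand n i j k l = sym (begin
        ∑[ m ∈ downFrom M ] a i j k l m * f m
          ≡⟨ ∑-cong (λ m → lem (e i m) (e j m) (e k m) (e l m) (f m)) (downFrom M) ⟩
        ∑[ m ∈ downFrom M ] (e i m * f m + ((- 1ℤ) * (e j m * f m) + ((- 1ℤ) * (e k m * f m) + e l m * f m)))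
          ≡⟨ trans (∑-+ (λ m → e i m * f m) (λ m → (- 1ℤ) * (e j m * f m) + ((- 1ℤ) * (e k m * f m) + e l m * f m)) (downFrom M))
             (cong₂ _+_ (unit-expand f (Fin.toℕ<n i))
               (trans (∑-+ (λ m → (- 1ℤ) * (e j m * f m)) (λ m → (- 1ℤ) * (e k m * f m) + e l m * f m) (downFrom M))
               (cong₂ _+_ (trans (∑-*ˡ (- 1ℤ) (λ m → e j m * f m) (downFrom M)) (cong ((- 1ℤ) *_) (unit-expand f (Fin.toℕ<n j))))
                 (trans (∑-+ (λ m → (- 1ℤ) * (e k m * f m)) (λ m → e l m * f m) (downFrom M))
                 (cong₂ _+_ (trans (∑-*ˡ (- 1ℤ) (λ m → e k m * f m) (downFrom M)) (cong ((- 1ℤ) *_) (unit-expand f (Fin.toℕ<n k))))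
                            (unit-expand f (Fin.toℕ<n l))))))) ⟩
        v n i + ((- 1ℤ) * v n j + ((- 1ℤ) * v n k + v n l))
          ≡⟨ lem′ (v n i) (v n j) (v n k) (v n l) ⟩
        (v n i - v n j) - (v n k - v n l) ∎)
        where
        open ≡-Reasoning
        e : Fin M → ℕ → ℤ
        e i = unit (toℕ i)
        f : ℕ → ℤ
        f m = + ((suc n ℕ.+ m) !)
        lem : ∀ a b c d f → ((a - b) - (c - d)) * f ≡ a * f + ((- 1ℤ) * (b * f) + ((- 1ℤ) * (c * f) + d * f))
        lem = solve-∀
        lem′ : ∀ a b c d → a + ((- 1ℤ) * b + ((- 1ℤ) * c + d)) ≡ (a - b) - (c - d)
        lem′ = solve-∀

      -- Apart from the trivial coincidences some coefficient is prime to p: the one at l if exactly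
      -- one equality of a trivial pattern starting with i = j or i = k fails, otherwise the one at
      -- i, which is 1, or 2 when l = i. The value 2 is the reason for p > 2.
      nontrivial : 2 ℕ.< p → ∀ i j k l → ((i ≡ j × k ≡ l) ⊎ (i ≡ k × j ≡ l)) ⊎ (∃[ m ] (m ℕ.< M × ¬ P ∣ a i j k l m))
      nontrivial 2<p i j k l with i Fin.≟ j | i Fin.≟ k | k Fin.≟ l | j Fin.≟ l
      ... | yes i≡j | _       | yes k≡l | _       = inj₁ (inj₁ (i≡j , k≡l))
      ... | _       | yes i≡k | _       | yes j≡l = inj₁ (inj₂ (i≡k , j≡l))
      ... | yes refl | _       | no k≢l  | _       = inj₂ (toℕ l , Fin.toℕ<n l , λ d → P∤1 (subst (P ∣_)
              (trans (cong₂ (λ x y → (unit (toℕ i) (toℕ l) - unit (toℕ i) (toℕ l)) - (x - y)) (unit-other (k≢l ∘ Fin.toℕ-injective)) (unit-same (toℕ l))) (lem (unit (toℕ i) (toℕ l)))) d))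
        where
        lem : ∀ x → (x - x) - (0ℤ - 1ℤ) ≡ 1ℤ
        lem = solve-∀
      ... | _       | yes refl | _       | no j≢l  = inj₂ (toℕ l , Fin.toℕ<n l , λ d → P∤1 (subst (P ∣_)
              (trans (cong₂ (λ x y → (unit (toℕ i) (toℕ l) - x) - (unit (toℕ i) (toℕ l) - y)) (unit-other (j≢l ∘ Fin.toℕ-injective)) (unit-same (toℕ l))) (lem (unit (toℕ i) (toℕ l)))) d))
        where
        lem : ∀ x → (x - 0ℤ) - (x - 1ℤ) ≡ 1ℤ
        lem = solve-∀
      ... | no i≢j  | no i≢k  | _       | _       = inj₂ (toℕ i , Fin.toℕ<n i , λ d → P∤1+unit (toℕ l ℕ.≟ toℕ i) (subst (P ∣_) value d))
        where
        lem : ∀ x → (1ℤ - 0ℤ) - (0ℤ - x) ≡ 1ℤ + x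
        lem = solve-∀
        value : a i j k l (toℕ i) ≡ 1ℤ + unit (toℕ l) (toℕ i)
        value = trans (cong₂ (λ x y → (x - y) - (unit (toℕ k) (toℕ i) - unit (toℕ l) (toℕ i))) (unit-same (toℕ i)) (unit-other (i≢j ∘ sym ∘ Fin.toℕ-injective)))
               (trans (cong (λ x → (1ℤ - 0ℤ) - (x - unit (toℕ l) (toℕ i))) (unit-other (i≢k ∘ sym ∘ Fin.toℕ-injective))) (lem (unit (toℕ l) (toℕ i))))
        P∤1+unit : ∀ {A : Set} (d : Dec A) → ¬ P ∣ 1ℤ + ind d
        P∤1+unit (yes _) d = contradiction (ℕ.∣⇒≤ (∣⇒∣ᵤ d)) (ℕ.<⇒≱ 2<p)
        P∤1+unit (no _)  d = P∤1 d

      -- Trivial quadruples, fewer than 2 M² for M > 0, may coincide for all N values of n; each of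
      -- the at most M⁴ others does so for at most M of them. Hence M³ ≤ N keeps the average energy
      -- of order M².
      block-average : 2 ℕ.< p → ∀ N → N ℕ.< p →
        ∑[ n ∈ downFrom N ] energy (cartesianProduct (allFin M) (allFin M)) (difference (v n))
          ≤ + M * (+ M * (+ N * + 2 + + M * (+ M * + M)))
      block-average 2<p N N<p = begin
        ∑[ n ∈ downFrom N ] energy (cartesianProduct Fs Fs) (difference (v n))
          ≡⟨ ∑-cong (λ n → trans (∑-product (λ d → ∑[ d′ ∈ cartesianProduct Fs Fs ] δ (difference (v n) d - difference (v n) d′)) _,_ Fs Fs)
               (∑-cong (λ i → ∑-cong (λ j → ∑-product (λ d′ → δ ((v n i - v n j) - difference (v n) d′)) _,_ Fs Fs) Fs) Fs)) (downFrom N) ⟩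
        ∑[ n ∈ downFrom N ] ∑[ i ∈ Fs ] ∑[ j ∈ Fs ] ∑[ k ∈ Fs ] ∑[ l ∈ Fs ] X i j k l n
          ≡⟨ trans (∑-swap (λ n i → ∑[ j ∈ Fs ] ∑[ k ∈ Fs ] ∑[ l ∈ Fs ] X i j k l n) (downFrom N) Fs)
             (∑-cong (λ i → trans (∑-swap (λ n j → ∑[ k ∈ Fs ] ∑[ l ∈ Fs ] X i j k l n) (downFrom N) Fs)
             (∑-cong (λ j → trans (∑-swap (λ n k → ∑[ l ∈ Fs ] X i j k l n) (downFrom N) Fs)
             (∑-cong (λ k → ∑-swap (λ n l → X i j k l n) (downFrom N) Fs) Fs)) Fs)) Fs) ⟩
        ∑[ i ∈ Fs ] ∑[ j ∈ Fs ] ∑[ k ∈ Fs ] ∑[ l ∈ Fs ] ∑[ n ∈ downFrom N ] X i j k l n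
          ≤⟨ ∑-mono (λ i → ∑-mono (λ j → ∑-mono (λ k → ∑-mono (λ l → quadruple i j k l) Fs) Fs) Fs) Fs ⟩
        ∑[ i ∈ Fs ] ∑[ j ∈ Fs ] ∑[ k ∈ Fs ] ∑[ l ∈ Fs ] (ι i j * + N * ι k l + (ι i k * + N * ι j l + + M))
          ≡⟨ ∑-cong (λ i → ∑-cong (λ j → ∑-cong (λ k → trans (∑-+ (λ l → ι i j * + N * ι k l) (λ l → ι i k * + N * ι j l + + M) Fs)
               (cong₂ _+_ (collapse (ι i j * + N) k) (trans (∑-+ (λ l → ι i k * + N * ι j l) (λ _ → + M) Fs) (cong₂ _+_ (collapse (ι i k * + N) j) (∑-allFin-const M (+ M)))))) Fs) Fs) Fs ⟩
        ∑[ i ∈ Fs ] ∑[ j ∈ Fs ] ∑[ k ∈ Fs ] (ι i j * + N + (ι i k * + N + + M * + M))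
          ≡⟨ ∑-cong (λ i → ∑-cong (λ j → trans (∑-+ (λ _ → ι i j * + N) (λ k → ι i k * + N + + M * + M) Fs)
               (cong₂ _+_ (trans (∑-allFin-const M (ι i j * + N)) (lem₁ (+ M) (ι i j) (+ N))) (trans (∑-+ (λ k → ι i k * + N) (λ _ → + M * + M) Fs) (cong₂ _+_ (collapse′ (+ N) i) (∑-allFin-const M (+ M * + M)))))) Fs) Fs ⟩
        ∑[ i ∈ Fs ] ∑[ j ∈ Fs ] (ι i j * (+ M * + N) + (+ N + + M * (+ M * + M)))
          ≡⟨ ∑-cong (λ i → trans (∑-+ (λ j → ι i j * (+ M * + N)) (λ _ → + N + + M * (+ M * + M)) Fs) (cong₂ _+_ (collapse′ (+ M * + N) i) (∑-allFin-const M (+ N + + M * (+ M * + M))))) Fs ⟩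
        ∑[ i ∈ Fs ] (+ M * + N + + M * (+ N + + M * (+ M * + M)))
          ≡⟨ trans (∑-allFin-const M (+ M * + N + + M * (+ N + + M * (+ M * + M)))) (lem₂ (+ M) (+ N)) ⟩
        + M * (+ M * (+ N * + 2 + + M * (+ M * + M))) ∎
        where
        open ≤-Reasoning
        Fs : List (Fin M)
        Fs = allFin M
        X : Fin M → Fin M → Fin M → Fin M → ℕ → ℤ
        X i j k l n = δ ((v n i - v n j) - (v n k - v n l))
        lem₁ : ∀ m i n → m * (i * n) ≡ i * (m * n)
        lem₁ = solve-∀
        lem₂ : ∀ m n → m * (m * n + m * (n + m * (m * m))) ≡ m * (m * (n * + 2 + m * (m * m)))
        lem₂ = solve-∀
        collapse : ∀ a (i : Fin M) → ∑[ j ∈ Fs ] a * ι i j ≡ a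
        collapse a i = trans (∑-*ˡ a (ι i) Fs) (trans (cong (a *_) (∑-ι i)) (*-identityʳ a))
        collapse′ : ∀ a (i : Fin M) → ∑[ j ∈ Fs ] ι i j * a ≡ a
        collapse′ a i = trans (∑-*ʳ a (ι i) Fs) (trans (cong (_* a) (∑-ι i)) (*-identityˡ a))
        0≤t : ∀ (i j k l : Fin M) → 0ℤ ≤ ι i j * + N * ι k l
        0≤t i j k l = 0≤* (0≤* (ind-nonNeg (i Fin.≟ j)) 0≤-pos) (ind-nonNeg (k Fin.≟ l))
        one : ∀ (i k : Fin M) → ι i i * + N * ι k k ≡ + N
        one i k = trans (cong₂ (λ x y → x * + N * y) (ind-yes (i Fin.≟ i) refl) (ind-yes (k Fin.≟ k) refl)) (trans (*-identityʳ (1ℤ * + N)) (*-identityˡ (+ N)))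
        quadruple : ∀ i j k l → ∑ (downFrom N) (X i j k l) ≤ ι i j * + N * ι k l + (ι i k * + N * ι j l + + M)
        quadruple i j k l with nontrivial 2<p i j k l
        ... | inj₁ (inj₁ (refl , refl)) = subst (_≤ ι i i * + N * ι k k + (ι i k * + N * ι i k + + M)) (+-identityʳ _)
                (+-mono-≤ (≤-trans (∑-δ≤ (λ n → (v n i - v n i) - (v n k - v n k)) N) (≤-reflexive (sym (one i k)))) (0≤+ (0≤t i k i k) 0≤-pos))
        ... | inj₁ (inj₂ (refl , refl)) = ≤-trans (∑-δ≤ (λ n → (v n i - v n j) - (v n i - v n j)) N) (≤-trans (≤-reflexive (trans (sym (one i j)) (trans (sym (+-identityʳ _)) (sym (+-identityˡ _)))))
                (+-mono-≤ (0≤t i j i j) (+-monoʳ-≤ (ι i i * + N * ι j j) 0≤-pos)))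
        ... | inj₂ (m , m<M , P∤am) = ≤-trans (≤-reflexive (∑-cong (λ n → cong δ (v-expand n i j k l)) (downFrom N)))
                (≤-trans (factorial-roots M (a i j k l) m m<M P∤am N N<p)
                (≤-trans (≤-reflexive (trans (sym (+-identityˡ (+ M))) (sym (+-identityˡ (0ℤ + + M)))))
                (+-mono-≤ (0≤t i j k l) (+-monoˡ-≤ (+ M) (0≤t i k j l)))))

  -- Sums of factorials taken from disjoint intervals

  length-cartesianProductWith : ∀ {A B C : Set} (f : A → B → C) xs ys →
                                length (cartesianProductWith f xs ys) ≡ length xs ℕ.* length ys
  length-cartesianProductWith f []       ys = refl
  length-cartesianProductWith f (x ∷ xs) ys = trans (length-++ (map (f x) ys))
    (cong₂ ℕ._+_ (length-map (f x) ys) (length-cartesianProductWith f xs ys))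

  tuples : ∀ K l → List (Vec (Fin K) l)
  tuples K zero    = [] ∷ []
  tuples K (suc l) = cartesianProductWith _∷_ (allFin K) (tuples K l)

  length-tuples : ∀ K l → length (tuples K l) ≡ K ℕ.^ l
  length-tuples K zero    = refl
  length-tuples K (suc l) = trans (length-cartesianProductWith _∷_ (allFin K) (tuples K l)) (cong₂ ℕ._*_ (length-allFin K) (length-tuples K l))

  -- The entries of a tuple are read as offsets into consecutive disjoint intervals of length K.
  offset : ∀ {K} → ℕ → Fin K → ℕ
  offset {K} l k = l ℕ.* K ℕ.+ toℕ k

  offset< : ∀ {K} l (k : Fin K) → offset l k ℕ.< suc l ℕ.* K
  offset< {K} l k = subst (offset l k ℕ.<_) (ℕ.+-comm (l ℕ.* K) K) (ℕ.+-monoʳ-< (l ℕ.* K) (Fin.toℕ<n k))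

  factorial-sum : ∀ {K l} → ℕ → Vec (Fin K) l → ℤ
  factorial-sum n []              = 0ℤ
  factorial-sum n (_∷_ {n = l} k t) = + ((suc n ℕ.+ offset l k) !) + factorial-sum n t

  -- Equality of tuples as a product of Kronecker deltas, so that its sum over all tuples
  -- factorises.
  same : ∀ {K l} → Vec (Fin K) l → Vec (Fin K) l → ℤ
  same []      []      = 1ℤ
  same (i ∷ s) (j ∷ t) = ι i j * same s t

  same-refl : ∀ {K l} (t : Vec (Fin K) l) → same t t ≡ 1ℤ
  same-refl []      = refl
  same-refl (i ∷ t) = cong₂ _*_ (ind-yes (i Fin.≟ i) refl) (same-refl t)

  same-nonNeg : ∀ {K l} (s t : Vec (Fin K) l) → 0ℤ ≤ same s t
  same-nonNeg []      []      = 0≤-pos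
  same-nonNeg (i ∷ s) (j ∷ t) = 0≤* (ind-nonNeg (i Fin.≟ j)) (same-nonNeg s t)

  ∑-same : ∀ {K l} (s : Vec (Fin K) l) → ∑[ t ∈ tuples K l ] same s t ≡ 1ℤ
  ∑-same         []                = refl
  ∑-same {K} {suc l} (i ∷ s) = begin
    ∑ (tuples K (suc l)) (same (i ∷ s))                          ≡⟨ ∑-product (same (i ∷ s)) _∷_ (allFin K) (tuples K l) ⟩
    ∑[ j ∈ allFin K ] ∑[ t ∈ tuples K l ] ι i j * same s t       ≡⟨ ∑-*-∑ (ι i) (same s) (allFin K) (tuples K l) ⟩
    ∑ (allFin K) (ι i) * ∑ (tuples K l) (same s)                 ≡⟨ cong₂ _*_ (∑-ι i) (∑-same s) ⟩
    1ℤ                                                           ∎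
    where open ≡-Reasoning

  -- Coincidences between sums of factorials

  module TupleAverage (p : ℕ) (p-prime : Prime p) where

    open Residues p p-prime
    open Families p p-prime
    open Roots p p-prime
    open Averages p p-prime

    coefficient : ∀ {K l} → Vec (Fin K) l → ℕ → ℤ
    coefficient []                m = 0ℤ
    coefficient (_∷_ {n = l} k t) m = unit (offset l k) m + coefficient t m

    coefficient-above : ∀ {K l} (t : Vec (Fin K) l) m → l ℕ.* K ℕ.≤ m → coefficient t m ≡ 0ℤ
    coefficient-above []                    m _    = refl
    coefficient-above {K} (_∷_ {n = l} k t) m lK≤m = cong₂ _+_
      (unit-other (ℕ.<⇒≢ (ℕ.<-≤-trans (offset< l k) lK≤m)))
      (coefficient-above t m (ℕ.≤-trans (ℕ.m≤n+m (l ℕ.* K) K) lK≤m))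

    factorial-sum-expand : ∀ {K l} n (t : Vec (Fin K) l) M → l ℕ.* K ℕ.≤ M →
      factorial-sum n t ≡ ∑[ m ∈ downFrom M ] coefficient t m * + ((suc n ℕ.+ m) !)
    factorial-sum-expand n [] M _ = sym (trans (∑-cong (λ m → *-zeroˡ (+ ((suc n ℕ.+ m) !))) (downFrom M)) (∑-zero (downFrom M)))
    factorial-sum-expand {K} n (_∷_ {n = l} k t) M lK≤M = sym (begin
      ∑[ m ∈ downFrom M ] (unit (offset l k) m + coefficient t m) * f m
        ≡⟨ ∑-cong (λ m → *-distribʳ-+ (f m) (unit (offset l k) m) (coefficient t m)) (downFrom M) ⟩
      ∑[ m ∈ downFrom M ] (unit (offset l k) m * f m + coefficient t m * f m)
        ≡⟨ ∑-+ (λ m → unit (offset l k) m * f m) (λ m → coefficient t m * f m) (downFrom M) ⟩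
      (∑[ m ∈ downFrom M ] unit (offset l k) m * f m) + (∑[ m ∈ downFrom M ] coefficient t m * f m)
        ≡⟨ cong₂ _+_ (unit-expand f (ℕ.<-≤-trans (offset< l k) lK≤M)) (sym (factorial-sum-expand n t M (ℕ.≤-trans (ℕ.m≤n+m (l ℕ.* K) K) lK≤M))) ⟩
      f (offset l k) + factorial-sum n t ∎)
      where
      open ≡-Reasoning
      f : ℕ → ℤ
      f m = + ((suc n ℕ.+ m) !)

    -- Look at the first place where the tuples differ. Equal earlier entries cancel, and all later
    -- entries lie in lower intervals, so at the offset of the entry of s the coefficients are 1
    -- against 0, up to a common summand.
    separate : ∀ {K l} (s t : Vec (Fin K) l) → s ≡ t ⊎ (∃[ m ] (m ℕ.< l ℕ.* K × coefficient s m - coefficient t m ≡ 1ℤ))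
    separate []      []      = inj₁ refl
    separate {K} (_∷_ {n = l} i s) (j ∷ t) with i Fin.≟ j
    ... | no i≢j = inj₂ (offset l i , offset< l i , cong₂ _-_
            (cong₂ _+_ (unit-same (offset l i)) (coefficient-above s (offset l i) (ℕ.m≤m+n (l ℕ.* K) (toℕ i))))
            (cong₂ _+_ (unit-other (λ eq → i≢j (Fin.toℕ-injective (sym (ℕ.+-cancelˡ-≡ (l ℕ.* K) (toℕ j) (toℕ i) eq))))) (coefficient-above t (offset l i) (ℕ.m≤m+n (l ℕ.* K) (toℕ i)))))
    ... | yes refl with separate s t
    ...   | inj₁ refl = inj₁ refl
    ...   | inj₂ (m , m<lK , eq) = inj₂ (m , ℕ.<-≤-trans m<lK (ℕ.m≤n+m (l ℕ.* K) K) , trans (lem (unit (offset l i) m) (coefficient s m) (coefficient t m)) eq)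
      where
      lem : ∀ u a b → (u + a) - (u + b) ≡ a - b
      lem = solve-∀

    -- Equal tuples coincide for all N values of n, distinct ones for at most l K of them. With Z
    -- tuples and Z K ≤ N the average energy is then at most (l + 1) Z.
    tuple-average : ∀ K l N → N ℕ.< p →
      ∑[ n ∈ downFrom N ] energy (tuples K l) (factorial-sum n) ≤ + length (tuples K l) * (+ N + + length (tuples K l) * + (l ℕ.* K))
    tuple-average K l N N<p = begin
      ∑[ n ∈ downFrom N ] ∑[ s ∈ Ts ] ∑[ t ∈ Ts ] X s t n
        ≡⟨ trans (∑-swap (λ n s → ∑[ t ∈ Ts ] X s t n) (downFrom N) Ts) (∑-cong (λ s → ∑-swap (λ n t → X s t n) (downFrom N) Ts) Ts) ⟩
      ∑[ s ∈ Ts ] ∑[ t ∈ Ts ] ∑[ n ∈ downFrom N ] X s t n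
        ≤⟨ ∑-mono (λ s → ∑-mono (pair s) Ts) Ts ⟩
      ∑[ s ∈ Ts ] ∑[ t ∈ Ts ] (same s t * + N + + M)
        ≡⟨ ∑-cong (λ s → trans (∑-+ (λ t → same s t * + N) (λ _ → + M) Ts) (cong₂ _+_ (trans (∑-*ʳ (+ N) (same s) Ts) (trans (cong (_* + N) (∑-same s)) (*-identityˡ (+ N)))) (∑-const (+ M) Ts))) Ts ⟩
      ∑[ s ∈ Ts ] (+ N + + length Ts * + M)
        ≡⟨ ∑-const (+ N + + length Ts * + M) Ts ⟩
      + length Ts * (+ N + + length Ts * + M) ∎
      where
      open ≤-Reasoning
      M : ℕ
      M = l ℕ.* K
      Ts : List (Vec (Fin K) l)
      Ts = tuples K l
      X : Vec (Fin K) l → Vec (Fin K) l → ℕ → ℤ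
      X s t n = δ (factorial-sum n s - factorial-sum n t)
      expand : ∀ s t n → factorial-sum n s - factorial-sum n t ≡ ∑[ m ∈ downFrom M ] (coefficient s m - coefficient t m) * + ((suc n ℕ.+ m) !)
      expand s t n = sym (begin-equality
        ∑[ m ∈ downFrom M ] (coefficient s m - coefficient t m) * f m
          ≡⟨ ∑-cong (λ m → lem (coefficient s m) (coefficient t m) (f m)) (downFrom M) ⟩
        ∑[ m ∈ downFrom M ] (coefficient s m * f m + (- 1ℤ) * (coefficient t m * f m))
          ≡⟨ ∑-+ (λ m → coefficient s m * f m) (λ m → (- 1ℤ) * (coefficient t m * f m)) (downFrom M) ⟩
        (∑[ m ∈ downFrom M ] coefficient s m * f m) + (∑[ m ∈ downFrom M ] (- 1ℤ) * (coefficient t m * f m))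
          ≡⟨ cong₂ _+_ (sym (factorial-sum-expand n s M ℕ.≤-refl)) (trans (∑-*ˡ (- 1ℤ) (λ m → coefficient t m * f m) (downFrom M)) (trans (cong ((- 1ℤ) *_) (sym (factorial-sum-expand n t M ℕ.≤-refl))) (-1*i≡-i (factorial-sum n t)))) ⟩
        factorial-sum n s - factorial-sum n t ∎)
        where
        f : ℕ → ℤ
        f m = + ((suc n ℕ.+ m) !)
        lem : ∀ a b c → (a - b) * c ≡ a * c + (- 1ℤ) * (b * c)
        lem = solve-∀
      pair : ∀ s t → ∑ (downFrom N) (X s t) ≤ same s t * + N + + M
      pair s t with separate s t
      ... | inj₁ refl = ≤-trans (∑-δ≤ (λ n → factorial-sum n s - factorial-sum n s) N)
              (≤-trans (≤-reflexive (sym (trans (+-identityʳ (same s s * + N)) (trans (cong (_* + N) (same-refl s)) (*-identityˡ (+ N)))))) (+-monoʳ-≤ (same s s * + N) 0≤-pos))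
      ... | inj₂ (m , m<M , eq) = ≤-trans (≤-reflexive (∑-cong (λ n → cong δ (expand s t n)) (downFrom N)))
              (≤-trans (factorial-roots M (λ m → coefficient s m - coefficient t m) m m<M (λ d → P∤1 (subst (P ∣_) eq d)) N N<p)
              (≤-trans (≤-reflexive (sym (+-identityˡ (+ M)))) (+-monoˡ-≤ (+ M) (0≤* (same-nonNeg s t) 0≤-pos))))

  -- Combining the inequalities

  positive : ∀ m .{{_ : ℕ.NonZero m}} → Positive (+ m)
  positive (suc m) = _

  any-tuple? : ∀ {K l} {Q : Vec (Fin K) l → Set} → (∀ t → Dec (Q t)) → Dec (∃[ t ] Q t)
  any-tuple? {l = zero}  Q? = map′ (λ q → [] , q) (λ { ([] , q) → q }) (Q? [])
  any-tuple? {l = suc l} Q? = map′ (λ { (k , t , q) → (k ∷ t) , q }) (λ { ((k ∷ t) , q) → k , t , q })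
                                   (Fin.any? (λ k → any-tuple? (λ t → Q? (k ∷ t))))

  -- With H = G V² Z³, `first` and E ≤ k Z give H ≤ k W once Z G is cancelled. Squaring and
  -- inserting the other bounds estimates N H², and cancelling V² G Z² leaves the claim. The factor
  -- N stays because S is controlled only through an average over N blocks.
  combine-bounds : ∀ N G V Z P k {E W L S e} .{{_ : Positive G}} .{{_ : Positive V}} .{{_ : Positive Z}} →
    0ℤ ≤ N → 0ℤ ≤ G → 0ℤ ≤ V → 0ℤ ≤ Z → 0ℤ ≤ P → 0ℤ ≤ k → 0ℤ ≤ S → 0ℤ ≤ G * W → 0ℤ ≤ e →
    (Z * (G * (V * Z))) * (Z * (G * (V * Z))) ≤ E * (G * W) →
    W * W ≤ L * S →
    N * S ≤ G * (N * (P * P * (Z * Z) * e) + G * (G * (P * (e * e)))) →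
    e ≤ P * P * E → E ≤ k * Z → L ≤ + 3 * (V * V) →
    N * (G * V * V * Z * Z * Z * Z) ≤ + 3 * (k * k) * (k * (N * (P * P * P * P) * Z) + k * k * (G * G * (P * P * P * P * P)))
  combine-bounds N G V Z P k {E} {W} {L} {S} {e} 0≤N 0≤G 0≤V 0≤Z 0≤P 0≤k 0≤S 0≤GW 0≤e first second third e≤ E≤ L≤ =
    *-cancelˡ-≤-pos _ _ Z (*-cancelˡ-≤-pos _ _ Z (*-cancelˡ-≤-pos _ _ G (*-cancelˡ-≤-pos _ _ V (*-cancelˡ-≤-pos _ _ V total))))
    where
    open ≤-Reasoning
    H e′ : ℤ
    H = G * V * V * Z * Z * Z
    e′ = P * P * (k * Z)
    0≤H : 0ℤ ≤ H
    0≤H = 0≤* (0≤* (0≤* (0≤* (0≤* 0≤G 0≤V) 0≤V) 0≤Z) 0≤Z) 0≤Z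
    e≤e′ : e ≤ e′
    e≤e′ = ≤-trans e≤ (*-monoˡ (P * P) (0≤-square P) E≤)
    0≤e′ : 0ℤ ≤ e′
    0≤e′ = ≤-trans 0≤e e≤e′
    lem₁ : ∀ G V Z → Z * (G * (G * V * V * Z * Z * Z)) ≡ (Z * (G * (V * Z))) * (Z * (G * (V * Z)))
    lem₁ = solve-∀
    lem₂ : ∀ k Z G W → (k * Z) * (G * W) ≡ Z * (G * (k * W))
    lem₂ = solve-∀
    H≤kW : H ≤ k * W
    H≤kW = *-cancelˡ-≤-pos _ _ G (*-cancelˡ-≤-pos _ _ Z (begin
      Z * (G * H)                              ≡⟨ lem₁ G V Z ⟩
      (Z * (G * (V * Z))) * (Z * (G * (V * Z))) ≤⟨ first ⟩
      E * (G * W)                              ≤⟨ *-monoʳ (G * W) 0≤GW E≤ ⟩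
      (k * Z) * (G * W)                        ≡⟨ lem₂ k Z G W ⟩
      Z * (G * (k * W))                        ∎))
    lem₃ : ∀ k W → (k * W) * (k * W) ≡ k * k * (W * W)
    lem₃ = solve-∀
    H²≤ : H * H ≤ k * k * (+ 3 * (V * V) * S)
    H²≤ = begin
      H * H                          ≤⟨ *-mono 0≤H (≤-trans 0≤H H≤kW) H≤kW H≤kW ⟩
      (k * W) * (k * W)              ≡⟨ lem₃ k W ⟩
      k * k * (W * W)                ≤⟨ *-monoˡ (k * k) (0≤-square k) second ⟩
      k * k * (L * S)                ≤⟨ *-monoˡ (k * k) (0≤-square k) (*-monoʳ S 0≤S L≤) ⟩
      k * k * (+ 3 * (V * V) * S)    ∎
    lem₄ : ∀ N G V Z → V * (V * (G * (Z * (Z * (N * (G * V * V * Z * Z * Z * Z)))))) ≡ N * ((G * V * V * Z * Z * Z) * (G * V * V * Z * Z * Z))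
    lem₄ = solve-∀
    lem₅ : ∀ N V k S → N * (k * k * (+ 3 * (V * V) * S)) ≡ (+ 3 * (k * k) * (V * V)) * (N * S)
    lem₅ = solve-∀
    lem₆ : ∀ N G V Z P k → (+ 3 * (k * k) * (V * V)) * (G * (N * (P * P * (Z * Z) * (P * P * (k * Z))) + G * (G * (P * ((P * P * (k * Z)) * (P * P * (k * Z)))))))
           ≡ V * (V * (G * (Z * (Z * (+ 3 * (k * k) * (k * (N * (P * P * P * P) * Z) + k * k * (G * G * (P * P * P * P * P))))))))
    lem₆ = solve-∀
    0≤3kkVV : 0ℤ ≤ + 3 * (k * k) * (V * V)
    0≤3kkVV = 0≤* (0≤* (0≤-pos {3}) (0≤-square k)) (0≤-square V)
    total : V * (V * (G * (Z * (Z * (N * (G * V * V * Z * Z * Z * Z)))))) ≤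
            V * (V * (G * (Z * (Z * (+ 3 * (k * k) * (k * (N * (P * P * P * P) * Z) + k * k * (G * G * (P * P * P * P * P))))))))
    total = begin
      V * (V * (G * (Z * (Z * (N * (G * V * V * Z * Z * Z * Z))))))                     ≡⟨ lem₄ N G V Z ⟩
      N * (H * H)                                                                       ≤⟨ *-monoˡ N 0≤N H²≤ ⟩
      N * (k * k * (+ 3 * (V * V) * S))                                                 ≡⟨ lem₅ N V k S ⟩
      (+ 3 * (k * k) * (V * V)) * (N * S)                                               ≤⟨ *-monoˡ (+ 3 * (k * k) * (V * V)) 0≤3kkVV third ⟩
      (+ 3 * (k * k) * (V * V)) * (G * (N * (P * P * (Z * Z) * e) + G * (G * (P * (e * e)))))
        ≤⟨ *-monoˡ (+ 3 * (k * k) * (V * V)) 0≤3kkVV (*-monoˡ G 0≤G (+-mono-≤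
             (*-monoˡ N 0≤N (*-monoˡ (P * P * (Z * Z)) (0≤* (0≤-square P) (0≤-square Z)) e≤e′))
             (*-monoˡ G 0≤G (*-monoˡ G 0≤G (*-monoˡ P 0≤P (*-mono 0≤e 0≤e′ e≤e′ e≤e′)))))) ⟩
      (+ 3 * (k * k) * (V * V)) * (G * (N * (P * P * (Z * Z) * e′) + G * (G * (P * (e′ * e′)))))
        ≡⟨ lem₆ N G V Z P k ⟩
      V * (V * (G * (Z * (Z * (+ 3 * (k * k) * (k * (N * (P * P * P * P) * Z) + k * k * (G * G * (P * P * P * P * P)))))))) ∎

  -- What the absence of a solution would force. The two terms on the right stem from the diagonal
  -- and the off-diagonal pairs of dilates.
  Deficient : (N G M Z p k : ℕ) → Set
  Deficient N G M Z p k =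
    N ℕ.* (G ℕ.* M ℕ.* M ℕ.* Z ℕ.* Z ℕ.* Z ℕ.* Z) ℕ.≤
    3 ℕ.* (k ℕ.* k) ℕ.* (k ℕ.* (N ℕ.* (p ℕ.* p ℕ.* p ℕ.* p) ℕ.* Z) ℕ.+ k ℕ.* k ℕ.* (G ℕ.* G ℕ.* (p ℕ.* p ℕ.* p ℕ.* p ℕ.* p)))

  private
    infixl 7 _⊠_
    infixl 6 _⊞_

    -- Together with `_⊞_` and `#` this transports an expression from ℕ to ℤ by repeating its shape.
    _⊠_ : ∀ {a b x y} → + a ≡ x → + b ≡ y → + (a ℕ.* b) ≡ x * y
    _⊠_ {a} {b} refl refl = pos-* a b

    _⊞_ : ∀ {a b x y} → + a ≡ x → + b ≡ y → + (a ℕ.+ b) ≡ x + y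
    refl ⊞ refl = refl

    # : ∀ a → + a ≡ + a
    # a = refl

  module Existence (p : ℕ) (p-prime : Prime p) (2<p : 2 ℕ.< p) (K l N M G : ℕ)
    .{{_ : ℕ.NonZero K}} .{{_ : ℕ.NonZero N}} .{{_ : ℕ.NonZero M}} .{{_ : ℕ.NonZero G}}
    (N<p : N ℕ.< p) (G+N≤p : G ℕ.+ N ℕ.≤ p) (ZK≤N : K ℕ.^ l ℕ.* K ℕ.≤ N) (M³≤N : M ℕ.* (M ℕ.* M) ℕ.≤ N) where

    open Residues p p-prime
    open Families p p-prime
    open Averages p p-prime
    open Block M using (v; block-average)
    open TupleAverage p p-prime

    dilate : ℕ → Fin G → ℤ
    dilate n i = + (suc (toℕ i ℕ.+ n) !)

    record Solution (target : ℤ) : Set where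
      field
        n₀ n₁ n₂ : ℕ
        n₀<N : n₀ ℕ.< N
        n₁<N : n₁ ℕ.< N
        n₂<N : n₂ ℕ.< N
        t₀ t₁ : Vec (Fin K) l
        i : Fin G
        j : Fin M
        solves : P ∣ target - factorial-sum n₀ t₁ - dilate n₂ i * v n₁ j - factorial-sum n₀ t₀

    Z k : ℕ
    Z = K ℕ.^ l
    k = suc l

    tuple-block : ∃[ n ] (n ℕ.< N × energy (tuples K l) (factorial-sum n) ≤ + k * + Z)
    tuple-block with below-average (λ n → energy (tuples K l) (factorial-sum n)) N
    ... | n , n<N , avg = n , n<N , *-cancelˡ-≤-pos _ _ (+ N) {{positive N}} (begin
      + N * energy (tuples K l) (factorial-sum n)     ≤⟨ avg ⟩
      _                                               ≤⟨ tuple-average K l N N<p ⟩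
      + length (tuples K l) * (+ N + + length (tuples K l) * + (l ℕ.* K)) ≡⟨ cong (λ z → + z * (+ N + + z * + (l ℕ.* K))) (length-tuples K l) ⟩
      + Z * (+ N + + Z * + (l ℕ.* K))                 ≡⟨ cong (λ a → + Z * (+ N + a)) (trans (sym (pos-* Z (l ℕ.* K))) (trans (cong +_ (swap Z l K)) (pos-* l (Z ℕ.* K)))) ⟩
      + Z * (+ N + + l * + (Z ℕ.* K))                 ≤⟨ *-monoˡ (+ Z) 0≤-pos (+-monoʳ-≤ (+ N) (*-monoˡ (+ l) 0≤-pos (+≤+ ZK≤N))) ⟩
      + Z * (+ N + + l * + N)                         ≡⟨ lem (+ Z) (+ N) (+ l) ⟩
      + N * ((1ℤ + + l) * + Z)                        ∎)
      where
      open ≤-Reasoning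
      swap : ∀ a b c → a ℕ.* (b ℕ.* c) ≡ b ℕ.* (a ℕ.* c)
      swap a b c = trans (sym (ℕ.*-assoc a b c)) (trans (cong (ℕ._* c) (ℕ.*-comm a b)) (ℕ.*-assoc b a c))
      lem : ∀ z n l → z * (n + l * n) ≡ n * ((1ℤ + l) * z)
      lem = solve-∀

    -- A Sidon set up to a constant: the trivial coincidences alone number 2 M² - M.
    sidon-block : ∃[ n ] (n ℕ.< N × energy (cartesianProduct (allFin M) (allFin M)) (difference (v n)) ≤ + 3 * (+ M * + M))
    sidon-block with below-average (λ n → energy (cartesianProduct (allFin M) (allFin M)) (difference (v n))) N
    ... | n , n<N , avg = n , n<N , *-cancelˡ-≤-pos _ _ (+ N) {{positive N}} (begin
      + N * energy (cartesianProduct (allFin M) (allFin M)) (difference (v n)) ≤⟨ avg ⟩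
      _                                             ≤⟨ block-average 2<p N N<p ⟩
      + M * (+ M * (+ N * + 2 + + M * (+ M * + M))) ≤⟨ *-monoˡ (+ M) 0≤-pos (*-monoˡ (+ M) 0≤-pos (+-monoʳ-≤ (+ N * + 2) (subst (_≤ + N) (# M ⊠ (# M ⊠ # M)) (+≤+ M³≤N)))) ⟩
      + M * (+ M * (+ N * + 2 + + N))               ≡⟨ lem (+ M) (+ N) ⟩
      + N * (+ 3 * (+ M * + M))                     ∎)
      where
      open ≤-Reasoning
      lem : ∀ m n → m * (m * (n * + 2 + n)) ≡ n * (+ 3 * (m * m))
      lem = solve-∀

    -- All unknowns range over finite sets, so a search settles constructively whether the target is
    -- reached, and its failure is the hypothesis of `Bilinear`.
    solve-or-deficient : ∀ target → Solution target ⊎ Deficient N G M Z p k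
    solve-or-deficient target with tuple-block | sidon-block
    ... | n₀ , n₀<N , E≤ | n₁ , n₁<N , L≤ = helper
      where
      open Balanced (tuples K l) (factorial-sum n₀)
      open Dilates h h-periodic h-balanced G N G+N≤p using (T; dilate-average)

      b : ℤ
      b = P * P * (n * n) * c₀

      0≤c₀ : 0ℤ ≤ c₀
      0≤c₀ = ∮-nonNeg (λ z → 0≤-square (h z))

      0≤b : 0ℤ ≤ b
      0≤b = 0≤* (0≤* (0≤-square P) (0≤-square n)) 0≤c₀

      helper : Solution target ⊎ Deficient N G M Z p k
      helper with below-average (λ m → ∑[ i ∈ allFin G ] ∑[ j ∈ allFin G ] T m i j) N
      ... | n₂ , n₂<N , avg
        with any-tuple? (λ s → any-tuple? (λ t → Fin.any? (λ i → Fin.any? (λ j →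
               P ∣? (target - factorial-sum n₀ t - dilate n₂ i * v n₁ j - factorial-sum n₀ s)))))
      ...   | yes (s , t , i , j , solves) = inj₁ (record
                { n₀<N = n₀<N ; n₁<N = n₁<N ; n₂<N = n₂<N ; t₀ = s ; t₁ = t ; i = i ; j = j ; solves = solves })
      ...   | no unsolved = inj₂ (drop‿+≤+ (subst₂ _≤_
                (sym (# N ⊠ (# G ⊠ # M ⊠ # M ⊠ # Z ⊠ # Z ⊠ # Z ⊠ # Z)))
                (sym (# 3 ⊠ (# k ⊠ # k) ⊠ (# k ⊠ (# N ⊠ (# p ⊠ # p ⊠ # p ⊠ # p) ⊠ # Z) ⊞ # k ⊠ # k ⊠ (# G ⊠ # G ⊠ (# p ⊠ # p ⊠ # p ⊠ # p ⊠ # p)))))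
                bound))
        where
        open Bilinear (tuples K l) (factorial-sum n₀) (tuples K l) (factorial-sum n₀) (allFin G) (dilate n₂) (allFin M) (v n₁) target
               (λ s t i j d → unsolved (s , t , i , j , d))
               using (W; S; first-bound; second-bound; U*W-nonNeg; S-nonNeg)

        G≡ : + length (allFin G) ≡ + G
        G≡ = cong +_ (length-allFin G)
        M≡ : + length (allFin M) ≡ + M
        M≡ = cong +_ (length-allFin M)
        Z≡ : n ≡ + Z
        Z≡ = cong +_ (length-tuples K l)

        bound : + N * (+ G * + M * + M * + Z * + Z * + Z * + Z) ≤ + 3 * (+ k * + k) * (+ k * (+ N * (P * P * P * P) * + Z) + + k * + k * (+ G * + G * (P * P * P * P * P)))
        bound = combine-bounds (+ N) (+ G) (+ M) (+ Z) P (+ k) {{positive G}} {{positive M}} {{positive Z {{ℕ.m^n≢0 K l}}}}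
          0≤-pos 0≤-pos 0≤-pos 0≤-pos 0≤-pos 0≤-pos S-nonNeg
          (subst (λ g → 0ℤ ≤ g * W) G≡ U*W-nonNeg) 0≤c₀
          (subst (λ z → (z * (+ G * (+ M * z))) * (z * (+ G * (+ M * z))) ≤ energy (tuples K l) (factorial-sum n₀) * (+ G * W)) Z≡
            (subst₂ (λ g m → (n * (g * (m * n))) * (n * (g * (m * n))) ≤ energy (tuples K l) (factorial-sum n₀) * (g * W)) G≡ M≡ first-bound))
          second-bound
          (≤-trans avg (≤-trans (dilate-average 0≤b ∮-c²) (≤-reflexive (cong (λ z → + G * (+ N * (P * P * (z * z) * c₀) + + G * (+ G * (P * (c₀ * c₀))))) Z≡))))
          c₀≤ E≤ L≤

open Counting

open import Defs
open import Data.Nat using (ℕ; zero; suc; _+_; _*_; _^_; _≤_; _<_; _!)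
open import Data.Nat.Primality using (Prime)
open import Data.Fin using (Fin; toℕ)
open import Data.Integer using (ℤ; +_; _-_)
open import Data.Integer.Divisibility using (_∣_)
open import Data.Vec.Base using (Vec; []; _∷_; _++_; lookup)
open import Data.Vec.Relation.Unary.All using (All; []; _∷_)
open import Data.Vec.Relation.Unary.All.Properties using (++⁺; lookup⁺)

-- Powers of q and the exponents

integer-root : ∀ s .{{_ : ℕ.NonZero s}} n → ∃[ q ] (q ^ s ≤ n × n < suc q ^ s)
integer-root (suc s) zero    = 0 , ℕ.z≤n , ℕ.≤-reflexive (sym (ℕ.^-zeroˡ (suc s)))
integer-root s       (suc n) with integer-root s n
... | q , q^s≤n , n<q^s with suc q ^ s ℕ.≤? suc n
...   | yes q^s≤ = suc q , q^s≤ , ℕ.≤-<-trans n<q^s (ℕ.^-monoˡ-< s (ℕ.n<1+n (suc q)))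
...   | no  q^s≰ = q , ℕ.m≤n⇒m≤1+n q^s≤n , ℕ.≰⇒> q^s≰

-- A product of powers of q together with its total exponent; multiplying such records by `_⊛_`
-- proves the exponent law for a whole product at once.
record Power (q : ℕ) : Set where
  field
    exponent value : ℕ
    proof          : q ^ exponent ≡ value

-- Here a, b, c, d, s are the exponents of q in N, G, M, Z and (up to the factor Q) p.
¬deficient : ∀ q Q p k a b c d s e → 0 < q →
  p ≤ Q * q ^ s →
  a + (b + c + c + d + d + d + d) ≡ suc e → a + (s + s + s + s) + d ≡ e → b + b + (s + s + s + s + s) ≡ e →
  3 * (k * k) * (k * (Q * Q * Q * Q) + k * k * (Q * Q * Q * Q * Q)) < q →
  ¬ Deficient (q ^ a) (q ^ b) (q ^ c) (q ^ d) p k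
¬deficient q Q p k a b c d s e 0<q p≤ left right₁ right₂ R<q deficient = ℕ.<-irrefl refl (begin-strict
  q * q ^ e
    ≡⟨ cong (q ^_) (sym left) ⟩
  q ^ (a + (b + c + c + d + d + d + d))
    ≡⟨ proof (pow a ⊛ (pow b ⊛ pow c ⊛ pow c ⊛ pow d ⊛ pow d ⊛ pow d ⊛ pow d)) ⟩
  q ^ a * (q ^ b * q ^ c * q ^ c * q ^ d * q ^ d * q ^ d * q ^ d)
    ≤⟨ deficient ⟩
  3 * (k * k) * (k * (q ^ a * (p * p * p * p) * q ^ d) + k * k * (q ^ b * q ^ b * (p * p * p * p * p)))
    ≤⟨ ℕ.*-monoʳ-≤ (3 * (k * k)) (ℕ.+-mono-≤ (ℕ.*-monoʳ-≤ k (ℕ.*-monoˡ-≤ (q ^ d) (ℕ.*-monoʳ-≤ (q ^ a) p⁴≤))) (ℕ.*-monoʳ-≤ (k * k) (ℕ.*-monoʳ-≤ (q ^ b * q ^ b) (ℕ.*-mono-≤ p⁴≤ p≤)))) ⟩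
  3 * (k * k) * (k * (q ^ a * (y * y * y * y) * q ^ d) + k * k * (q ^ b * q ^ b * (y * y * y * y * y)))
    ≡⟨ rearrange (3 * (k * k)) k (q ^ a) Q x (q ^ d) (q ^ b) ⟩
  3 * (k * k) * (k * (Q * Q * Q * Q) * (q ^ a * (x * x * x * x) * q ^ d) + k * k * (Q * Q * Q * Q * Q) * (q ^ b * q ^ b * (x * x * x * x * x)))
    ≡⟨ cong₂ (λ u w → 3 * (k * k) * (k * (Q * Q * Q * Q) * u + k * k * (Q * Q * Q * Q * Q) * w)) power₁ power₂ ⟩
  3 * (k * k) * (k * (Q * Q * Q * Q) * q ^ e + k * k * (Q * Q * Q * Q * Q) * q ^ e)
    ≡⟨ collect (3 * (k * k)) (k * (Q * Q * Q * Q)) (k * k * (Q * Q * Q * Q * Q)) (q ^ e) ⟩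
  3 * (k * k) * (k * (Q * Q * Q * Q) + k * k * (Q * Q * Q * Q * Q)) * q ^ e
    <⟨ ℕ.*-monoˡ-< (q ^ e) {{ℕ.m^n≢0 q e {{ℕ.>-nonZero 0<q}}}} R<q ⟩
  q * q ^ e ∎)
  where
  open ℕ.≤-Reasoning
  x y : ℕ
  x = q ^ s
  y = Q * x
  open Power
  infixl 7 _⊛_
  pow : ℕ → Power q
  pow i = record { exponent = i ; value = q ^ i ; proof = refl }
  _⊛_ : Power q → Power q → Power q
  f ⊛ g = record
    { exponent = exponent f + exponent g
    ; value    = value f * value g
    ; proof    = trans (ℕ.^-distribˡ-+-* q (exponent f) (exponent g)) (cong₂ _*_ (proof f) (proof g))
    }
  p⁴≤ : p * p * p * p ≤ y * y * y * y
  p⁴≤ = ℕ.*-mono-≤ (ℕ.*-mono-≤ (ℕ.*-mono-≤ p≤ p≤) p≤) p≤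
  power₁ : q ^ a * (x * x * x * x) * q ^ d ≡ q ^ e
  power₁ = trans (sym (proof (pow a ⊛ (pow s ⊛ pow s ⊛ pow s ⊛ pow s) ⊛ pow d))) (cong (q ^_) right₁)
  power₂ : q ^ b * q ^ b * (x * x * x * x * x) ≡ q ^ e
  power₂ = trans (sym (proof (pow b ⊛ pow b ⊛ (pow s ⊛ pow s ⊛ pow s ⊛ pow s ⊛ pow s)))) (cong (q ^_) right₂)
  rearrange : ∀ r k A Q x D B → r * (k * (A * (Q * x * (Q * x) * (Q * x) * (Q * x)) * D) + k * k * (B * B * (Q * x * (Q * x) * (Q * x) * (Q * x) * (Q * x))))
              ≡ r * (k * (Q * Q * Q * Q) * (A * (x * x * x * x) * D) + k * k * (Q * Q * Q * Q * Q) * (B * B * (x * x * x * x * x)))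
  rearrange = ℕ.solve-∀
  collect : ∀ r a b c → r * (a * c + b * c) ≡ r * (a + b) * c
  collect = ℕ.solve-∀

^-distribʳ-* : ∀ o m n → (m * n) ^ o ≡ m ^ o * n ^ o
^-distribʳ-* zero    m n = refl
^-distribʳ-* (suc o) m n = trans (cong (m * n *_) (^-distribʳ-* o m n)) (lem m n (m ^ o) (n ^ o))
  where
  lem : ∀ a b c d → a * b * (c * d) ≡ a * c * (b * d)
  lem = ℕ.solve-∀

-- The bound x ≤ 2 p^(f/e) with roots cleared: q^a ≤ p^(a/s), and a/s ≤ f/e.
power-bound : ∀ p q a s e f .{{_ : ℕ.NonZero q}} → a * e ≤ s * f → q ^ s ≤ p → ∀ x → x ≤ 2 * q ^ a → x ^ e ≤ 2 ^ e * p ^ f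
power-bound p q a s e f ae≤sf q^s≤p x x≤ = begin
  x ^ e                  ≤⟨ ℕ.^-monoˡ-≤ e x≤ ⟩
  (2 * q ^ a) ^ e        ≡⟨ ^-distribʳ-* e 2 (q ^ a) ⟩
  2 ^ e * (q ^ a) ^ e    ≡⟨ cong (2 ^ e *_) (ℕ.^-*-assoc q a e) ⟩
  2 ^ e * q ^ (a * e)    ≤⟨ ℕ.*-monoʳ-≤ (2 ^ e) (ℕ.^-monoʳ-≤ q ae≤sf) ⟩
  2 ^ e * q ^ (s * f)    ≡⟨ cong (2 ^ e *_) (sym (ℕ.^-*-assoc q s f)) ⟩
  2 ^ e * (q ^ s) ^ f    ≤⟨ ℕ.*-monoʳ-≤ (2 ^ e) (ℕ.^-monoˡ-≤ f q^s≤p) ⟩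
  2 ^ e * p ^ f          ∎
  where open ℕ.≤-Reasoning

-- Index vectors, their bounds and the thresholds

sum! : ∀ {m} → Vec ℕ m → ℕ
sum! {m} xs = finSum m (λ i → lookup xs i !)

sum!-++ : ∀ {m n} (xs : Vec ℕ m) (ys : Vec ℕ n) → sum! (xs ++ ys) ≡ sum! xs + sum! ys
sum!-++ []       ys = refl
sum!-++ (x ∷ xs) ys = trans (cong (λ a → x ! + a) (sum!-++ xs ys)) (sym (ℕ.+-assoc (x !) (sum! xs) (sum! ys)))

indices : ∀ {K l} → ℕ → Vec (Fin K) l → Vec ℕ l
indices n []                = []
indices n (_∷_ {n = l} k t) = (suc n + offset l k) ∷ indices n t

sum!-indices : ∀ {K l} n (t : Vec (Fin K) l) → + sum! (indices n t) ≡ factorial-sum n t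
sum!-indices n []                = refl
sum!-indices n (_∷_ {n = l} k t) = cong (λ a → + ((suc n + offset l k) !) ℤ.+ a) (sum!-indices n t)

Index : ℕ → ℕ → Set
Index B x = 0 < x × x ≤ B

-- The start n + 1 and the offset within the block are each at most N; here arises the constant 2 of
-- the final bound.
indices-bounded : ∀ {K l} n N (t : Vec (Fin K) l) → n < N → l * K ≤ N → All (Index (2 * N)) (indices n t)
indices-bounded n N []                n<N _    = []
indices-bounded {K} n N (_∷_ {n = l} k t) n<N lK≤N =
  (ℕ.s≤s ℕ.z≤n , ℕ.+-mono-≤ n<N (ℕ.≤-trans (ℕ.<⇒≤ (offset< l k)) (ℕ.≤-trans lK≤N (ℕ.m≤m+n N 0)))) ∷
  indices-bounded n N t n<N (ℕ.≤-trans (ℕ.m≤n+m (l * K) K) lK≤N)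

-- The factor R in the inequality q^(e+1) ≤ R q^e that `Deficient` implies when p ≤ Q q^s.
constant : ℕ → ℕ → ℕ
constant k Q = 3 * (k * k) * (k * (Q * Q * Q * Q) + k * k * (Q * Q * Q * Q * Q))

-- Since p < (q + 1)^s, such a lower bound on p forces q > l + 2 + `constant`. The summand l + 2
-- secures l K ≤ N and 2 N ≤ p.
threshold : ℕ → ℕ → ℕ
threshold l s = suc (suc (suc l) + constant (suc l) (2 ^ s)) ^ s

-- The lengths N, G, M, K are the powers q^a, q^b, q^c, q^d of q = ⌊p^(1/(a+1))⌋. The inequality to be refuted
-- bounds q^(e+1) by a constant multiple of q^e.
module Construction (l a b c d e x y : ℕ)
  (b≤a : b ≤ a) (c≤a : c ≤ a) (1+d≤a : suc d ≤ a) (dl+d≡a : d * l + d ≡ a) (3c≡a : c + (c + c) ≡ a)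
  (left : a + (b + c + c + d * l + d * l + d * l + d * l) ≡ suc e)
  (right₁ : a + (suc a + suc a + suc a + suc a) + d * l ≡ e)
  (right₂ : b + b + (suc a + suc a + suc a + suc a + suc a) ≡ e)
  (ax≤sy : a * x ≤ suc a * y)
  (p : ℕ) (p-prime : Prime p) (large : threshold l (suc a) ≤ p) (λ' : ℤ) where

  s z : ℕ
  s = suc a
  z = d * l

  root : ∃[ q ] (q ^ s ≤ p × p < suc q ^ s)
  root = integer-root s p

  q : ℕ
  q = proj₁ root

  q^s≤p : q ^ s ≤ p
  q^s≤p = proj₁ (proj₂ root)

  q-large : suc (suc l) + constant (suc l) (2 ^ s) < q
  q-large = ℕ.≰⇒> λ q≤ → ℕ.<⇒≱ (proj₂ (proj₂ root)) (ℕ.≤-trans (ℕ.^-monoˡ-≤ s (ℕ.s≤s q≤)) large)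

  2+l<q : suc (suc l) < q
  2+l<q = ℕ.≤-<-trans (ℕ.m≤m+n (suc (suc l)) (constant (suc l) (2 ^ s))) q-large

  2<q : 2 < q
  2<q = ℕ.≤-<-trans (ℕ.m≤m+n 2 l) 2+l<q

  instance
    q≢0 : ℕ.NonZero q
    q≢0 = ℕ.>-nonZero (ℕ.≤-<-trans ℕ.z≤n 2+l<q)

  K N M G : ℕ
  K = q ^ d
  N = q ^ a
  M = q ^ c
  G = q ^ b

  instance
    K≢0 : ℕ.NonZero K
    K≢0 = ℕ.m^n≢0 q d
    N≢0 : ℕ.NonZero N
    N≢0 = ℕ.m^n≢0 q a
    M≢0 : ℕ.NonZero M
    M≢0 = ℕ.m^n≢0 q c
    G≢0 : ℕ.NonZero G
    G≢0 = ℕ.m^n≢0 q b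

  2N≤p : 2 * N ≤ p
  2N≤p = ℕ.≤-trans (ℕ.*-monoˡ-≤ N (ℕ.<⇒≤ 2<q)) q^s≤p

  N<p : N < p
  N<p = ℕ.<-≤-trans (ℕ.m<m+n N (ℕ.<-≤-trans (ℕ.>-nonZero⁻¹ N) (ℕ.m≤m+n N 0))) 2N≤p

  q≤p : q ≤ p
  q≤p = ℕ.≤-trans (ℕ.m≤m*n q N) q^s≤p

  G≤N : G ≤ N
  G≤N = ℕ.^-monoʳ-≤ q b≤a

  M≤N : M ≤ N
  M≤N = ℕ.^-monoʳ-≤ q c≤a

  +-≤-2N : ∀ {x y} → x ≤ N → y ≤ N → x + y ≤ 2 * N
  +-≤-2N x≤N y≤N = ℕ.+-mono-≤ x≤N (ℕ.≤-trans y≤N (ℕ.m≤m+n N 0))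

  ZK≡N : K ^ l * K ≡ N
  ZK≡N = trans (cong (_* K) (ℕ.^-*-assoc q d l)) (trans (sym (ℕ.^-distribˡ-+-* q z d)) (cong (q ^_) dl+d≡a))

  M³≡N : M * (M * M) ≡ N
  M³≡N = trans (cong (M *_) (sym (ℕ.^-distribˡ-+-* q c c))) (trans (sym (ℕ.^-distribˡ-+-* q c (c + c))) (cong (q ^_) 3c≡a))

  lK≤N : l * K ≤ N
  lK≤N = ℕ.≤-trans (ℕ.*-monoˡ-≤ K (ℕ.≤-trans (ℕ.m≤n+m l 2) (ℕ.<⇒≤ 2+l<q))) (ℕ.^-monoʳ-≤ q 1+d≤a)

  -- From p < (q + 1)^s and q + 1 ≤ 2 q; this is the origin of Q = 2^s.
  p≤2^sq^s : p ≤ 2 ^ s * q ^ s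
  p≤2^sq^s = begin
    p                 ≤⟨ ℕ.<⇒≤ (proj₂ (proj₂ root)) ⟩
    suc q ^ s       ≤⟨ ℕ.^-monoˡ-≤ s (ℕ.+-mono-≤ (ℕ.>-nonZero⁻¹ q) (ℕ.m≤m+n q 0)) ⟩
    (2 * q) ^ s     ≡⟨ ^-distribʳ-* s 2 q ⟩
    2 ^ s * q ^ s ∎
    where open ℕ.≤-Reasoning

  open Existence p p-prime (ℕ.<-≤-trans 2<q q≤p) K l N M G
         N<p (ℕ.≤-trans (+-≤-2N G≤N ℕ.≤-refl) 2N≤p) (ℕ.≤-reflexive ZK≡N) (ℕ.≤-reflexive M³≡N)

  sufficient : ¬ Deficient N G M (K ^ l) p (suc l)
  sufficient = subst (λ z → ¬ Deficient N G M z p (suc l)) (sym (ℕ.^-*-assoc q d l))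
    (¬deficient q (2 ^ s) p (suc l) a b c z s e (ℕ.>-nonZero⁻¹ q) p≤2^sq^s left right₁ right₂
      (ℕ.≤-<-trans (ℕ.m≤n+m (constant (suc l) (2 ^ s)) (suc (suc l))) q-large))

  bound : ∀ {r} → r ≤ 2 * N → r ^ x ≤ 2 ^ x * p ^ y
  bound {r} = power-bound p q a s x y ax≤sy q^s≤p r

  Conclusion : Set
  Conclusion = Σ ℕ λ m → Σ ℕ λ n → Σ (Fin (l + (l + 1)) → ℕ) λ ns →
    (0 < m) × (0 < n) × ((i : Fin (l + (l + 1))) → 0 < ns i) ×
    (m ^ x ≤ 2 ^ x * p ^ y) × (n ^ x ≤ 2 ^ x * p ^ y) ×
    ((i : Fin (l + (l + 1))) → ns i ^ x ≤ 2 ^ x * p ^ y) ×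
    ((+ p) ∣ ((+ (m ! * n ! + finSum (l + (l + 1)) (λ i → ns i !))) - λ'))

  conclude : Solution (λ' - + 1) → Conclusion
  conclude sol = m , n , lookup xs , ℕ.s≤s ℕ.z≤n , ℕ.s≤s ℕ.z≤n , (λ i → proj₁ (lookup⁺ all i)) ,
          bound m≤ , bound n≤ , (λ i → bound (proj₂ (lookup⁺ all i))) ,
          Signed.∣⇒∣ᵤ (subst (Signed._∣_ (+ p)) total (Signed.∣m⇒∣-m solves))
    where
    open Solution sol
    m n : ℕ
    m = suc (toℕ i + n₂)
    n = suc n₁ + toℕ j
    xs : Vec ℕ (l + (l + 1))
    -- The closing entry contributes 1!, which the lowered target λ' - 1 compensates; it brings the
    -- number of summands from 2 l to 2 l + 1.
    xs = indices n₀ t₀ ++ (indices n₀ t₁ ++ (1 ∷ []))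
    m≤ : m ≤ 2 * N
    m≤ = ℕ.≤-trans (ℕ.<⇒≤ (ℕ.+-mono-≤-< (ℕ.≤-trans (Fin.toℕ<n i) G≤N) n₂<N)) (+-≤-2N ℕ.≤-refl ℕ.≤-refl)
    n≤ : n ≤ 2 * N
    n≤ = +-≤-2N n₁<N (ℕ.≤-trans (ℕ.<⇒≤ (Fin.toℕ<n j)) M≤N)
    all : All (Index (2 * N)) xs
    all = ++⁺ (indices-bounded n₀ N t₀ n₀<N lK≤N) (++⁺ (indices-bounded n₀ N t₁ n₀<N lK≤N)
            ((ℕ.s≤s ℕ.z≤n , ℕ.≤-trans (ℕ.>-nonZero⁻¹ N) (ℕ.m≤m+n N (N + 0))) ∷ []))
    ring : ∀ f g u v w → ℤ.- (w - + 1 - v - f ℤ.* g - u) ≡ f ℤ.* g ℤ.+ (u ℤ.+ (v ℤ.+ + 1)) - w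
    ring = ℤ.solve-∀
    total : ℤ.- (λ' - + 1 - factorial-sum n₀ t₁ - + (m !) ℤ.* + (n !) - factorial-sum n₀ t₀) ≡ + (m ! * n ! + sum! xs) - λ'
    total = trans (ring (+ (m !)) (+ (n !)) (factorial-sum n₀ t₀) (factorial-sum n₀ t₁) λ')
                  (cong (λ z → z - λ') (cong₂ ℤ._+_ (sym (ℤ.pos-* (m !) (n !))) (sym sum≡)))
      where
      sum≡ : + sum! xs ≡ factorial-sum n₀ t₀ ℤ.+ (factorial-sum n₀ t₁ ℤ.+ + 1)
      sum≡ = trans (cong +_ (trans (sum!-++ (indices n₀ t₀) (indices n₀ t₁ ++ (1 ∷ []))) (cong (λ a → sum! (indices n₀ t₀) + a) (sum!-++ (indices n₀ t₁) (1 ∷ [])))))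
                   (cong₂ (λ a b → a ℤ.+ (b ℤ.+ + 1)) (sum!-indices n₀ t₀) (sum!-indices n₀ t₁))

  solution : Conclusion
  solution = [ conclude , (λ deficient → contradiction deficient sufficient) ]′ (solve-or-deficient (λ' - + 1))

theorem2 : Σ ℕ λ C → 0 < C × Σ ℕ λ P₀ → (p : ℕ) → Prime p → P₀ ≤ p → (λ' : ℤ) →
    Σ ℕ λ m → Σ ℕ λ n → Σ (Fin 47 → ℕ) λ ns →
    (0 < m) × (0 < n) × ((i : Fin 47) → 0 < ns i) ×
    (m ^ 1301 ≤ C ^ 1301 * p ^ 1300) × (n ^ 1301 ≤ C ^ 1301 * p ^ 1300) ×
    ((i : Fin 47) → ns i ^ 1301 ≤ C ^ 1301 * p ^ 1300) ×
    ((+ p) ∣ ((+ (m ! * n ! + finSum 47 (λ i → ns i !))) - λ'))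
theorem2 = 2 , ℕ.s≤s ℕ.z≤n , threshold 23 265 ,
  -- Here l = 23, and K^24 = M³ = N = q^a give d = a/24 and c = a/3. The exponent b = 126 balances
  -- the two terms on the right of `Deficient`: 2 b = a + 23 d - (a + 1), and both have exponent
  -- 1577. The left side then exceeds them by q^(a/48 - 9/2) up to constants, and a = 264 makes this
  -- power exactly q. The last argument compares 264/265 with 1300/1301 after clearing denominators.
  Construction.solution 23 264 126 88 11 1577 1301 1300
    (ℕ.≤ᵇ⇒≤ 126 264 tt) (ℕ.≤ᵇ⇒≤ 88 264 tt) (ℕ.≤ᵇ⇒≤ 12 264 tt) refl refl refl refl refl (ℕ.≤ᵇ⇒≤ 343464 344500 tt)
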